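{- Let $G=(V_1,E_1)$ be a connected graph with $|V_1|\ge2$ and $H=(V_2,E_2)$ a $\kappa$-regular graph on $n=|V_2|$ vertices, where $n\ge1$ and $\kappa\ge0$. Let $A_H$ be the adjacency matrix of $H$ and assume that $\min\mathrm{ev}(A_H)=-2$. Then \[ \mathrm{QEC}(G\odot H)=\begin{cases}\psi_{H*}^{ -1}(\mathrm{QEC}(G)), & \text{if } \mathrm{QEC}(G)>0,\\ 0,&\text{otherwise,}\end{cases} \] where \[ \psi_{H*}^{ -1}(\mathrm{QEC}(G))=\frac12\Bigl\{(n+1)\mathrm{QEC}(G)-(\kappa+2)+\sqrt{((n+1)\mathrm{QEC}(G)-(\kappa+2))^2+4(\kappa+2)\mathrm{QEC}(G)}\,\Bigr\}. \]
   Context: All graphs are finite, simple and undirected. For a connected graph $G=(V,E)$ with $|V|\ge2$ and distance matrix $D=[d(x,y)]_{x,y\in V}$ (graph distance), $\mathrm{QEC}(G)=\max\{\langle f,Df\rangle\,;\, f\in C(V),\ \langle f,f\rangle=1,\ \langle \mathbf{1},f\rangle=0\}$, where $C(V)$ is the space of real column vectors indexed by $V$ with the canonical inner product and $\mathbf{1}$ is the all-one vector. Corona: for graphs $G=(V_1,E_1)$, $H=(V_2,E_2)$ with $V_1\cap V_2=\emptyset$, $G\odot H$ is obtained from $G$ and $|V_1|$ disjoint copies of $H$ (one for each vertex of $G$) by joining each vertex of $G$ to every vertex of its copy of $H$. $\mathrm{ev}(A_H)$ denotes the set of distinct eigenvalues of $A_H$. The notation $\psi_{H*}^{ -1}$ refers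 to the inverse of the restriction to $(-\frac{\kappa+2}{n+1},+\infty)$ of $\psi_H(\lambda)=\frac{\lambda(\lambda+\kappa+2)}{(n+1)\lambda+\kappa+2}$; its value at $\mathrm{QEC}(G)$ is given explicitly by the formula in the claim. -}

module Defs where

open import Level using (Level; suc)
open import Algebra.Bundles using (CommutativeRing)
import Algebra.Definitions.RawMonoid as RawMonoidDefinitions
open import Data.Fin.Base using (Fin)
open import Data.Fin.Properties using (any?; inj⇒≟; +↔⊎; *↔×)
open import Data.Nat.Base as ℕ using (ℕ; z≤n; s≤s)
open import Data.Product using (∃; _×_; _,_; proj₁; proj₂)
open import Data.Product.Function.NonDependent.Propositional using (_×-↔_)
open import Data.Sum.Base using (_⊎_; inj₁; inj₂)
open import Data.Sum.Function.Propositional using (_⊎-↔_)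
open import Data.Vec.Base using (count; tabulate)
open import Function.Base using (_∘_)
open import Function.Bundles using (_↔_; Inverse)
open import Function.Construct.Composition using (_↔-∘_)
open import Function.Construct.Symmetry using (↔-sym)
open import Function.Properties.Inverse using (↔⇒↣)
open import Relation.Binary.Core using (Rel)
open import Relation.Binary.Definitions using (Decidable; DecidableEquality; Symmetric)
open import Relation.Binary.PropositionalEquality using (_≡_; refl; sym; subst)
open import Relation.Binary.Structures using (IsTotalOrder)
open import Relation.Nullary using (¬_; Dec; yes; no; does; contradiction)
open import Relation.Nullary.Decidable using (map′; _×-dec_)
open import Relation.Unary using (Pred)
import Relation.Unary as Unary
open import Data.Bool.Base using (if_then_else_)

private variable
  ℓ : Level

record Graph : Set₁ where
  field
    V         : Set
    order     : ℕ
    enum      : V ↔ Fin order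
    Adj       : Rel V _
    adj?      : Decidable Adj
    adj-sym   : Symmetric Adj
    adj-irr   : ∀ {x} → ¬ Adj x x

  vertex : Fin order → V
  vertex = Inverse.from enum

  infix 4 _≟ⱽ_
  _≟ⱽ_ : DecidableEquality V
  _≟ⱽ_ = inj⇒≟ (↔⇒↣ enum)

  degree : V → ℕ
  degree x = count (adj? x) (tabulate vertex)

  Regular : ℕ → Set
  Regular κ = ∀ x → degree x ≡ κ

  data Walk : V → V → ℕ → Set where
    nil  : ∀ {x} → Walk x x 0
    step : ∀ {x y z k} → Adj x y → Walk y z k → Walk x z (ℕ.suc k)

  Connected : Set
  Connected = ∀ x y → ∃ (Walk x y)

  anyⱽ? : {P : Pred V _} → Unary.Decidable P → Dec (∃ P)
  anyⱽ? {P} P? = map′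
    (λ (i , p) → vertex i , p)
    (λ (x , p) → Inverse.to enum x
               , subst P (sym (Inverse.strictlyInverseʳ enum x)) p)
    (any? (P? ∘ vertex))

  walk? : ∀ x y → Unary.Decidable (Walk x y)
  walk? x y ℕ.zero with x ≟ⱽ y
  ... | yes refl = yes nil
  ... | no  x≢y  = no λ { nil → x≢y refl }
  walk? x y (ℕ.suc k) = map′
    (λ (z , a , w) → step a w)
    (λ { (step {y = z} a w) → z , a , w })
    (anyⱽ? (λ z → adj? x z ×-dec walk? z y k))

least : {P : Pred ℕ ℓ} → Unary.Decidable P → ∃ P →
        ∃ λ m → P m × (∀ k → P k → m ℕ.≤ k)
least {P = P} P? (n , p) = go n P? p
  where
  go : ∀ n {Q : Pred ℕ _} → Unary.Decidable Q → Q n →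
       ∃ λ m → Q m × (∀ k → Q k → m ℕ.≤ k)
  go n Q? q with Q? 0
  ... | yes q₀ = 0 , q₀ , λ _ _ → z≤n
  go ℕ.zero    Q? q | no ¬q₀ = contradiction q ¬q₀
  go (ℕ.suc n) Q? q | no ¬q₀ with go n (Q? ∘ ℕ.suc) q
  ... | m , qm , min = ℕ.suc m , qm , λ
    { ℕ.zero    q₀ → contradiction q₀ ¬q₀
    ; (ℕ.suc k) qk → s≤s (min k qk) }

-- The least length of a walk from x to y.
dist : (G : Graph) → Graph.Connected G → (x y : Graph.V G) → ℕ
dist G conn x y = proj₁ (least (Graph.walk? G x y) (conn x y))

-- In G ⊙ H, inj₁ x is a vertex of G and inj₂ (x , u) is the vertex u in the
-- copy of H attached to x.
module _ (G H : Graph) where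
  private
    module G = Graph G
    module H = Graph H

  coronaAdj : Rel (G.V ⊎ (G.V × H.V)) _
  coronaAdj (inj₁ x)       (inj₁ y)       = G.Adj x y
  coronaAdj (inj₁ x)       (inj₂ (y , v)) = x ≡ y
  coronaAdj (inj₂ (x , u)) (inj₁ y)       = x ≡ y
  coronaAdj (inj₂ (x , u)) (inj₂ (y , v)) = x ≡ y × H.Adj u v

  infixl 7 _⊙_
  _⊙_ : Graph
  _⊙_ = record
    { V       = G.V ⊎ (G.V × H.V)
    ; order   = G.order ℕ.+ G.order ℕ.* H.order
    ; enum    = ↔-sym +↔⊎ ↔-∘ (G.enum ⊎-↔ (↔-sym *↔× ↔-∘ (G.enum ×-↔ H.enum)))
    ; Adj     = coronaAdj
    ; adj?    = dec
    ; adj-sym = λ {p} {q} → symm p q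
    ; adj-irr = λ {p} → irr p
    }
    where
    dec : Decidable coronaAdj
    dec (inj₁ x)       (inj₁ y)       = G.adj? x y
    dec (inj₁ x)       (inj₂ (y , v)) = x G.≟ⱽ y
    dec (inj₂ (x , u)) (inj₁ y)       = x G.≟ⱽ y
    dec (inj₂ (x , u)) (inj₂ (y , v)) = (x G.≟ⱽ y) ×-dec H.adj? u v

    symm : ∀ p q → coronaAdj p q → coronaAdj q p
    symm (inj₁ _) (inj₁ _) a       = G.adj-sym a
    symm (inj₁ _) (inj₂ _) e       = sym e
    symm (inj₂ _) (inj₁ _) e       = sym e
    symm (inj₂ _) (inj₂ _) (e , a) = sym e , H.adj-sym a

    irr : ∀ p → ¬ coronaAdj p p
    irr (inj₁ _) a       = G.adj-irr a
    irr (inj₂ _) (_ , a) = H.adj-irr a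

  ⊙-connected : G.Connected → Graph.Connected _⊙_
  ⊙-connected conn p q = down p q
    where
    open Graph _⊙_ using (Walk; nil; step)

    base : ∀ {x y k} → G.Walk x y k → ∃ (Walk (inj₁ x) (inj₁ y))
    base G.nil        = 0 , nil
    base (G.step a w) = _ , step a (proj₂ (base w))

    snoc : ∀ {p q r k} → Walk p q k → coronaAdj q r → Walk p r (ℕ.suc k)
    snoc nil        b = step b nil
    snoc (step {y = s} a w) b = step {y = s} a (snoc w b)

    up : ∀ x q → ∃ (Walk (inj₁ x) q)
    up x (inj₁ y)       = base (proj₂ (conn x y))
    up x (inj₂ (y , v)) = _ , snoc (proj₂ (base (proj₂ (conn x y)))) refl

    down : ∀ p q → ∃ (Walk p q)
    down (inj₁ x)       q = up x q
    down (inj₂ (x , u)) q = _ , step {y = inj₁ x} refl (proj₂ (up x q))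

-- The real numbers, axiomatised as a (Dedekind-)complete ordered field;
-- classically it is determined up to isomorphism.  Nothing is assumed about 0# ⁻¹.
record CompleteOrderedField ℓ : Set (suc ℓ) where
  infix  4 _≤_ _<_
  infixl 7 _/_
  infix  8 _⁻¹

  field
    commutativeRing : CommutativeRing ℓ ℓ

  open CommutativeRing commutativeRing public

  field
    _⁻¹            : Carrier → Carrier
    ⁻¹-inverseʳ    : ∀ x → ¬ x ≈ 0# → x * x ⁻¹ ≈ 1#
    1≉0            : ¬ 1# ≈ 0#
    _≤_            : Rel Carrier ℓ
    isTotalOrder   : IsTotalOrder _≈_ _≤_
    +-monoʳ-≤      : ∀ z {x y} → x ≤ y → z + x ≤ z + y
    *-nonNegative  : ∀ {x y} → 0# ≤ x → 0# ≤ y → 0# ≤ x * y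

  UpperBound : Pred Carrier ℓ → Pred Carrier ℓ
  UpperBound P b = ∀ x → P x → x ≤ b

  field
    supremum : (P : Pred Carrier ℓ) → ∃ P → ∃ (UpperBound P) →
               ∃ λ s → UpperBound P s × (∀ b → UpperBound P b → s ≤ b)

  _<_ : Rel Carrier ℓ
  x < y = x ≤ y × ¬ x ≈ y

  _/_ : Carrier → Carrier → Carrier
  x / y = x * y ⁻¹

  open RawMonoidDefinitions +-rawMonoid public
    using (sum) renaming (_×_ to _·_)

  fromℕ : ℕ → Carrier
  fromℕ n = n · 1#

module Real (ℝ : CompleteOrderedField ℓ) where
  open CompleteOrderedField ℝ public
    using (Carrier; _≈_; _≤_; _<_; _+_; _*_; -_; _-_; _/_; _⁻¹; 0#; 1#; fromℕ)
  open CompleteOrderedField ℝ using (sum; UpperBound)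

  IsMaximum : Pred Carrier ℓ → Carrier → Set ℓ
  IsMaximum S m = S m × UpperBound S m

  IsMinimum : Pred Carrier ℓ → Carrier → Set ℓ
  IsMinimum S m = S m × (∀ x → S x → m ≤ x)

  -- s = √x
  IsSqrt : Carrier → Carrier → Set ℓ
  IsSqrt x s = 0# ≤ s × s * s ≈ x

  -- x = (f|I)⁻¹(y)
  IsInverseValue : Pred Carrier ℓ → (Carrier → Carrier) → Carrier → Carrier → Set ℓ
  IsInverseValue I f y x = I x × f x ≈ y × (∀ x′ → I x′ → f x′ ≈ y → x′ ≈ x)

  module _ (G : Graph) where
    open Graph G

    C : Set ℓ
    C = V → Carrier

    Matrix : Set ℓ
    Matrix = V → V → Carrier

    ∑ : C → Carrier
    ∑ f = sum (f ∘ vertex)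

    ⟨_,_⟩ : C → C → Carrier
    ⟨ f , g ⟩ = ∑ λ x → f x * g x

    𝟏 : C
    𝟏 _ = 1#

    apply : Matrix → C → C
    apply M f x = ∑ λ y → M x y * f y

    adjacencyMatrix : Matrix
    adjacencyMatrix x y = if does (adj? x y) then 1# else 0#

    distanceMatrix : Connected → Matrix
    distanceMatrix conn x y = fromℕ (dist G conn x y)

    ev : Matrix → Pred Carrier ℓ
    ev M μ = ∃ λ (f : C) → (¬ (∀ x → f x ≈ 0#)) × (∀ x → apply M f x ≈ μ * f x)

    -- q = QEC(G)
    IsQEC : Connected → Carrier → Set ℓ
    IsQEC conn = IsMaximum λ r →
      ∃ λ (f : C) → ⟨ f , f ⟩ ≈ 1# × ⟨ 𝟏 , f ⟩ ≈ 0# ×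
                    ⟨ f , apply (distanceMatrix conn) f ⟩ ≈ r

  -- ψ_H depends on H only through n and κ; its denominator is positive on
  -- ψ-domain, so the unspecified value of 0# ⁻¹ plays no role there.
  ψ : (n κ : ℕ) → Carrier → Carrier
  ψ n κ x = (x * (x + fromℕ (κ ℕ.+ 2))) / (fromℕ (n ℕ.+ 1) * x + fromℕ (κ ℕ.+ 2))

  ψ-domain : (n κ : ℕ) → Pred Carrier ℓ
  ψ-domain n κ x = - (fromℕ (κ ℕ.+ 2) / fromℕ (n ℕ.+ 1)) < x

-- Split F on G ⊙ H into g on G and h on the copies of H, and put
-- S x = g x + Σ_u h x u.  If Σ S = 0 then
--   ⟨F,DF⟩ = ⟨S,D_G S⟩ - Σ_x ⟨h x,(A_H + 2)(h x)⟩.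
-- As min ev(A_H) = -2, the matrix A_H + 2 is positive semidefinite, and
-- n ⟨h,(A_H + 2)h⟩ ≥ (κ + 2)(Σ h)² because 𝟏 is an eigenvector.
-- If QEC(G) = q > 0, the bound ⟨F,DF⟩ ≤ r ⟨F,F⟩ reduces vertex by vertex to a
-- binary quadratic form in (g x , Σ_u h x u), whose determinant vanishes exactly
-- when ψ(r) = q; its kernel, tensored with a maximiser of G, gives equality.
-- If q ≤ 0, the value 0 is attained by an eigenvector of A_H for -2 placed on one
-- copy; it is orthogonal to 𝟏.
-- Semidefiniteness of A_H + 2 rests on the largest c with ⟨x,Ax⟩ ≥ c ⟨x,x⟩ being an
-- eigenvalue: a positive semidefinite form is either singular or, by completing
-- squares, bounded below by a positive multiple of ⟨x,x⟩.

module Submission where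

open import Defs
open import Level using (Level)
import Algebra.Properties.AbelianGroup as AbelianGroupProperties
import Algebra.Properties.Ring as RingProperties
import Algebra.Properties.Semiring.Mult as SemiringMult
import Algebra.Properties.Semiring.Sum as SemiringSum
import Algebra.Solver.Ring as RingSolver
open import Algebra.Solver.Ring.AlmostCommutativeRing
  using (fromCommutativeRing; _-Raw-AlmostCommutative⟶_)
open import Axiom.ExcludedMiddle using (ExcludedMiddle)
open import Data.Bool.Base using (if_then_else_)
open import Data.Fin.Base using (Fin; zero; suc; punchIn; splitAt; remQuot; quotRem; fromℕ<)
open import Data.Fin.Properties using (_≟_; punchInᵢ≢i)
open import Data.Integer.Base as ℤ using (ℤ; +_; -[1+_])
import Data.Integer.Properties as ℤ
open import Data.Maybe.Base using (Maybe; just; nothing)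
open import Data.Nat.Base as ℕ using (ℕ; zero; suc; z≤n; s≤s)
import Data.Nat.Properties as ℕ
open import Data.Product as Product using (∃; _×_; _,_; proj₁; proj₂)
open import Data.Sum.Base as Sum using (_⊎_; inj₁; inj₂; [_,_]′)
open import Data.Vec.Base using (count; tabulate)
open import Data.Vec.Functional using (removeAt; _∷_)
open import Function.Base using (_∘_)
open import Function.Bundles using (Inverse)
import Relation.Binary.PropositionalEquality as ≡
open ≡ using (_≡_; _≢_)
import Relation.Binary.Reasoning.Setoid as SetoidReasoning
open import Relation.Binary.Structures using (IsTotalOrder)
open import Relation.Nullary using (¬_; Dec; yes; no; does; contradiction)
open import Relation.Nullary.Decidable using (dec-true; dec-false)

-- The value -2 is critical because distances inside one copy are 0, 1 or 2 and form the matrix 2J -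
-- (A_H + 2), with J all ones. The hypothesis on `ev` compares -2 only with eigenvalues that exist,
-- so an eigenvalue at the bottom of the form has to be produced; completeness and excluded middle
-- serve this purpose.
--
-- The function ψ comes from the inequality n q (g + t)² ≤ n r g² + (r + k) t² at one vertex, with k
-- = κ + 2 and t = Σ_u h x u. It is what remains, after multiplication by n, once ⟨h,h⟩ and ⟨h,(A_H
-- + 2)h⟩ are replaced by their lower bounds in t². Its determinant is n (r (r + k) - q ((n + 1) r +
-- k)). Both lower bounds are equalities for constant h, which is why the maximiser for q > 0 is
-- constant on each copy.
--
-- Replacing ⟨h,h⟩ in this way uses r ≥ 0. For q ≤ 0 the root of ψ(r) = q in the domain is at most
-- 0, and an eigenvector for -2, invisible to t, does at least as well with the value 0.

private variable
  ℓ : Level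

-- Complete ordered fields

module RealField (em : ExcludedMiddle ℓ) (ℝ : CompleteOrderedField ℓ) where
  open CompleteOrderedField ℝ public hiding (zero)
  open IsTotalOrder isTotalOrder public
    using (total; antisym)
    renaming (trans to ≤-trans; reflexive to ≤-reflexive; refl to ≤-refl)
  open RingProperties ring public
    using (-‿distribˡ-*; -‿distribʳ-*; -0#≈0#; -‿involutive)
  open AbelianGroupProperties +-abelianGroup public using (⁻¹-∙-comm)
  open SemiringMult semiring using (×-homo-+; ×1-homo-*; ×-congʳ; ×-assoc-*) public

  -- Integer coefficients have an equality that evaluates, so numerals such as 4 add up and cancel
  -- during normalisation; deciding equality of reals by excluded middle would not compute.
  module IntegerCoefficients where
    open SetoidReasoning setoid

    -- The special case + 1 makes the literals 1# and fromℕ 2 in a goal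
    -- definitionally equal to the solver's constants.
    ⟦_⟧ : ℤ → Carrier
    ⟦ + 1 ⟧      = 1#
    ⟦ + n ⟧      = fromℕ n
    ⟦ -[1+ n ] ⟧ = - fromℕ (suc n)

    ⟦+n⟧ : ∀ n → ⟦ + n ⟧ ≈ fromℕ n
    ⟦+n⟧ 0             = refl
    ⟦+n⟧ 1             = sym (+-identityʳ 1#)
    ⟦+n⟧ (suc (suc n)) = refl

    ⟦-n⟧ : ∀ n → ⟦ ℤ.- (+ n) ⟧ ≈ - fromℕ n
    ⟦-n⟧ 0       = sym -0#≈0#
    ⟦-n⟧ (suc n) = refl

    ⟦⟧-cong : ∀ {i j} → i ≡ j → ⟦ i ⟧ ≈ ⟦ j ⟧
    ⟦⟧-cong ≡.refl = refl

    cancel : ∀ a b c → (a + b) + - (a + c) ≈ b + - c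
    cancel a b c = begin
      (a + b) + - (a + c)    ≈⟨ +-cong (+-comm b a) (⁻¹-∙-comm a c) ⟨
      (b + a) + (- a + - c)  ≈⟨ +-assoc b a _ ⟩
      b + (a + (- a + - c))  ≈⟨ +-congˡ (+-assoc a (- a) (- c)) ⟨
      b + ((a + - a) + - c)  ≈⟨ +-congˡ (+-congʳ (-‿inverseʳ a)) ⟩
      b + (0# + - c)         ≈⟨ +-congˡ (+-identityˡ _) ⟩
      b + - c                ∎

    ⊖-homo : ∀ m n → ⟦ m ℤ.⊖ n ⟧ ≈ fromℕ m + - fromℕ n
    ⊖-homo m       zero    = begin
      ⟦ m ℤ.⊖ 0 ⟧       ≈⟨ ⟦+n⟧ m ⟩
      fromℕ m           ≈⟨ +-identityʳ _ ⟨
      fromℕ m + 0#      ≈⟨ +-congˡ -0#≈0# ⟨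
      fromℕ m + - 0#    ∎
    ⊖-homo zero    (suc n) = sym (+-identityˡ _)
    ⊖-homo (suc m) (suc n) = begin
      ⟦ suc m ℤ.⊖ suc n ⟧             ≈⟨ ⟦⟧-cong (ℤ.[1+m]⊖[1+n]≡m⊖n m n) ⟩
      ⟦ m ℤ.⊖ n ⟧                     ≈⟨ ⊖-homo m n ⟩
      fromℕ m + - fromℕ n             ≈⟨ cancel 1# (fromℕ m) (fromℕ n) ⟨
      fromℕ (suc m) + - fromℕ (suc n) ∎

    +-homo : ∀ i j → ⟦ i ℤ.+ j ⟧ ≈ ⟦ i ⟧ + ⟦ j ⟧
    +-homo (+ m) (+ n) = begin
      ⟦ + (m ℕ.+ n) ⟧    ≈⟨ ⟦+n⟧ (m ℕ.+ n) ⟩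
      fromℕ (m ℕ.+ n)    ≈⟨ ×-homo-+ 1# m n ⟩
      fromℕ m + fromℕ n  ≈⟨ +-cong (⟦+n⟧ m) (⟦+n⟧ n) ⟨
      ⟦ + m ⟧ + ⟦ + n ⟧  ∎
    +-homo (+ m) -[1+ n ] = trans (⊖-homo m (suc n)) (+-congʳ (sym (⟦+n⟧ m)))
    +-homo -[1+ m ] (+ n) =
      trans (⊖-homo n (suc m)) (trans (+-comm _ _) (+-congˡ (sym (⟦+n⟧ n))))
    +-homo -[1+ m ] -[1+ n ] = begin
      - fromℕ (suc (suc (m ℕ.+ n)))      ≈⟨ ⟦⟧-cong (≡.cong -[1+_] (≡.sym (ℕ.+-suc m n))) ⟩
      - fromℕ (suc m ℕ.+ suc n)          ≈⟨ -‿cong (×-homo-+ 1# (suc m) (suc n)) ⟩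
      - (fromℕ (suc m) + fromℕ (suc n))  ≈⟨ ⁻¹-∙-comm _ _ ⟨
      - fromℕ (suc m) + - fromℕ (suc n)  ∎

    -‿homo : ∀ i → ⟦ ℤ.- i ⟧ ≈ - ⟦ i ⟧
    -‿homo (+ n)    = trans (⟦-n⟧ n) (-‿cong (sym (⟦+n⟧ n)))
    -‿homo -[1+ n ] = trans (⟦+n⟧ (suc n)) (sym (-‿involutive _))

    *-homo⁺ : ∀ m j → ⟦ + m ℤ.* j ⟧ ≈ ⟦ + m ⟧ * ⟦ j ⟧
    *-homo⁺ m (+ n) = begin
      ⟦ + m ℤ.* + n ⟧    ≈⟨ ⟦⟧-cong (≡.sym (ℤ.pos-* m n)) ⟩
      ⟦ + (m ℕ.* n) ⟧    ≈⟨ ⟦+n⟧ (m ℕ.* n) ⟩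
      fromℕ (m ℕ.* n)    ≈⟨ ×1-homo-* m n ⟩
      fromℕ m * fromℕ n  ≈⟨ *-cong (⟦+n⟧ m) (⟦+n⟧ n) ⟨
      ⟦ + m ⟧ * ⟦ + n ⟧  ∎
    *-homo⁺ m -[1+ n ] = begin
      ⟦ + m ℤ.* -[1+ n ] ⟧          ≈⟨ ⟦⟧-cong (≡.sym (ℤ.neg-distribʳ-* (+ m) (+ suc n))) ⟩
      ⟦ ℤ.- (+ m ℤ.* + suc n) ⟧     ≈⟨ -‿homo (+ m ℤ.* + suc n) ⟩
      - ⟦ + m ℤ.* + suc n ⟧         ≈⟨ -‿cong (*-homo⁺ m (+ suc n)) ⟩
      - (⟦ + m ⟧ * ⟦ + suc n ⟧)     ≈⟨ -‿distribʳ-* _ _ ⟩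
      ⟦ + m ⟧ * - ⟦ + suc n ⟧       ≈⟨ *-congˡ (-‿cong (⟦+n⟧ (suc n))) ⟩
      ⟦ + m ⟧ * ⟦ -[1+ n ] ⟧        ∎

    *-homo : ∀ i j → ⟦ i ℤ.* j ⟧ ≈ ⟦ i ⟧ * ⟦ j ⟧
    *-homo (+ m)    j = *-homo⁺ m j
    *-homo -[1+ m ] j = begin
      ⟦ -[1+ m ] ℤ.* j ⟧         ≈⟨ ⟦⟧-cong (≡.sym (ℤ.neg-distribˡ-* (+ suc m) j)) ⟩
      ⟦ ℤ.- (+ suc m ℤ.* j) ⟧    ≈⟨ -‿homo (+ suc m ℤ.* j) ⟩
      - ⟦ + suc m ℤ.* j ⟧        ≈⟨ -‿cong (*-homo⁺ (suc m) j) ⟩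
      - (⟦ + suc m ⟧ * ⟦ j ⟧)    ≈⟨ -‿distribˡ-* _ _ ⟩
      - ⟦ + suc m ⟧ * ⟦ j ⟧      ≈⟨ *-congʳ (-‿cong (⟦+n⟧ (suc m))) ⟩
      ⟦ -[1+ m ] ⟧ * ⟦ j ⟧       ∎

    morphism : ℤ.+-*-rawRing -Raw-AlmostCommutative⟶ fromCommutativeRing commutativeRing
    morphism = record
      { ⟦_⟧    = ⟦_⟧
      ; +-homo = +-homo
      ; *-homo = *-homo
      ; -‿homo = -‿homo
      ; 0-homo = refl
      ; 1-homo = refl
      }

    _coeff≟_ : ∀ i j → Maybe (⟦ i ⟧ ≈ ⟦ j ⟧)
    i coeff≟ j with i ℤ.≟ j
    ... | yes i≡j = just (⟦⟧-cong i≡j)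
    ... | no  _   = nothing

  open RingSolver ℤ.+-*-rawRing (fromCommutativeRing commutativeRing)
    IntegerCoefficients.morphism IntegerCoefficients._coeff≟_ public
    using (solve; con; _:=_; _:+_; _:*_; _:-_; :-_)

  private variable
    x y z w : Carrier

  ≤-respʳ : y ≈ z → x ≤ y → x ≤ z
  ≤-respʳ y≈z x≤y = ≤-trans x≤y (≤-reflexive y≈z)

  ≤-respˡ : x ≈ z → x ≤ y → z ≤ y
  ≤-respˡ x≈z x≤y = ≤-trans (≤-reflexive (sym x≈z)) x≤y

  ≤-resp₂ : x ≈ z → y ≈ w → x ≤ y → z ≤ w
  ≤-resp₂ x≈z y≈w = ≤-respˡ x≈z ∘ ≤-respʳ y≈w

  x≤x+y : 0# ≤ y → x ≤ x + y
  x≤x+y 0≤y = ≤-respˡ (+-identityʳ _) (+-monoʳ-≤ _ 0≤y)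

  ≤-witness : 0# ≤ z → y ≈ x + z → x ≤ y
  ≤-witness 0≤z y≈x+z = ≤-respʳ (sym y≈x+z) (x≤x+y 0≤z)

  x≤y⇒0≤y-x : x ≤ y → 0# ≤ y - x
  x≤y⇒0≤y-x {x} {y} x≤y =
    ≤-resp₂ (-‿inverseˡ x) (+-comm _ _) (+-monoʳ-≤ (- x) x≤y)

  0≤y-x⇒x≤y : 0# ≤ y - x → x ≤ y
  0≤y-x⇒x≤y {y} {x} 0≤y-x = ≤-witness 0≤y-x
    (solve 2 (λ x y → y := x :+ (y :- x)) refl x y)

  +-nonNegative : 0# ≤ x → 0# ≤ y → 0# ≤ x + y
  +-nonNegative 0≤x 0≤y = ≤-trans 0≤x (x≤x+y 0≤y)

  +-mono-≤ : x ≤ y → z ≤ w → x + z ≤ y + w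
  +-mono-≤ {x} {y} {z} {w} x≤y z≤w = ≤-witness
    (+-nonNegative (x≤y⇒0≤y-x x≤y) (x≤y⇒0≤y-x z≤w))
    (solve 4 (λ x y z w → y :+ w := (x :+ z) :+ ((y :- x) :+ (w :- z))) refl x y z w)

  *-monoˡ-≤ : 0# ≤ z → x ≤ y → z * x ≤ z * y
  *-monoˡ-≤ {z} {x} {y} 0≤z x≤y = ≤-witness
    (*-nonNegative 0≤z (x≤y⇒0≤y-x x≤y))
    (solve 3 (λ x y z → z :* y := z :* x :+ z :* (y :- x)) refl x y z)

  x≤0⇒0≤-x : x ≤ 0# → 0# ≤ - x
  x≤0⇒0≤-x x≤0 = ≤-respʳ (+-identityˡ _) (x≤y⇒0≤y-x x≤0)

  0≤x*x : ∀ x → 0# ≤ x * x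
  0≤x*x x with total 0# x
  ... | inj₁ 0≤x = *-nonNegative 0≤x 0≤x
  ... | inj₂ x≤0 = ≤-respʳ
    (solve 1 (λ x → (:- x) :* (:- x) := x :* x) refl x)
    (*-nonNegative (x≤0⇒0≤-x x≤0) (x≤0⇒0≤-x x≤0))

  0≤1 : 0# ≤ 1#
  0≤1 = ≤-respʳ (*-identityˡ 1#) (0≤x*x 1#)

  fromℕ-nonNegative : ∀ n → 0# ≤ fromℕ n
  fromℕ-nonNegative zero    = ≤-refl
  fromℕ-nonNegative (suc n) = +-nonNegative 0≤1 (fromℕ-nonNegative n)

  x*y≈0⇒y≈0 : ¬ x ≈ 0# → x * y ≈ 0# → y ≈ 0#
  x*y≈0⇒y≈0 {x} {y} x≉0 xy≈0 = begin
    y               ≈⟨ *-identityˡ y ⟨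
    1# * y          ≈⟨ *-congʳ (⁻¹-inverseʳ x x≉0) ⟨
    x * x ⁻¹ * y    ≈⟨ solve 3 (λ x i y → x :* i :* y := i :* (x :* y)) refl x (x ⁻¹) y ⟩
    x ⁻¹ * (x * y)  ≈⟨ *-congˡ xy≈0 ⟩
    x ⁻¹ * 0#       ≈⟨ zeroʳ _ ⟩
    0#              ∎
    where open SetoidReasoning setoid

  0<x⇒x≉0 : 0# < x → ¬ x ≈ 0#
  0<x⇒x≉0 (_ , 0≉x) x≈0 = 0≉x (sym x≈0)

  x<y⇒y≰x : x < y → ¬ y ≤ x
  x<y⇒y≰x (x≤y , x≉y) y≤x = x≉y (antisym x≤y y≤x)

  <-≤-trans : x < y → y ≤ z → x < z
  <-≤-trans x<y@(x≤y , _) y≤z =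
    ≤-trans x≤y y≤z , λ x≈z → x<y⇒y≰x x<y (≤-respʳ (sym x≈z) y≤z)

  ≤-<-trans : x ≤ y → y < z → x < z
  ≤-<-trans x≤y y<z@(y≤z , _) =
    ≤-trans x≤y y≤z , λ x≈z → x<y⇒y≰x y<z (≤-respˡ x≈z x≤y)

  <-respʳ : y ≈ z → x < y → x < z
  <-respʳ y≈z x<y = <-≤-trans x<y (≤-reflexive y≈z)

  0<y-x⇒x<y : 0# < y - x → x < y
  0<y-x⇒x<y {y} {x} (0≤y-x , 0≉y-x) =
    0≤y-x⇒x≤y 0≤y-x , λ x≈y → 0≉y-x (trans (sym (-‿inverseʳ x)) (+-congʳ x≈y))

  x<y⇒0<y-x : x < y → 0# < y - x
  x<y⇒0<y-x {x} {y} (x≤y , x≉y) = x≤y⇒0≤y-x x≤y , λ 0≈y-x → x≉y (begin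
    x            ≈⟨ +-identityʳ x ⟨
    x + 0#       ≈⟨ +-congˡ 0≈y-x ⟩
    x + (y - x)  ≈⟨ solve 2 (λ x y → x :+ (y :- x) := y) refl x y ⟩
    y            ∎)
    where open SetoidReasoning setoid

  *-positive : 0# < x → 0# < y → 0# < x * y
  *-positive 0<x@(0≤x , _) 0<y@(0≤y , _) =
    *-nonNegative 0≤x 0≤y , λ 0≈xy → 0<x⇒x≉0 0<y (x*y≈0⇒y≈0 (0<x⇒x≉0 0<x) (sym 0≈xy))

  +-positive : 0# < x → 0# ≤ y → 0# < x + y
  +-positive 0<x 0≤y = <-≤-trans 0<x (x≤x+y 0≤y)

  0<1 : 0# < 1#
  0<1 = 0≤1 , 1≉0 ∘ sym

  fromℕ-positive : ∀ {n} → 1 ℕ.≤ n → 0# < fromℕ n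
  fromℕ-positive {suc n} _ = +-positive 0<1 (fromℕ-nonNegative n)

  ⁻¹-positive : 0# < x → 0# < x ⁻¹
  ⁻¹-positive {x} 0<x with total 0# (x ⁻¹)
  ... | inj₁ 0≤i = 0≤i , λ 0≈i → 1≉0
    (trans (sym (⁻¹-inverseʳ x (0<x⇒x≉0 0<x))) (trans (*-congˡ (sym 0≈i)) (zeroʳ x)))
  ... | inj₂ i≤0 = contradiction
    (≤-resp₂ (⁻¹-inverseʳ x (0<x⇒x≉0 0<x)) (zeroʳ x) (*-monoˡ-≤ (proj₁ 0<x) i≤0))
    (x<y⇒y≰x 0<1)

  /-cancel : 0# < y → y * (x / y) ≈ x
  /-cancel {y} {x} 0<y = begin
    y * (x / y)      ≈⟨ solve 3 (λ x y i → y :* (x :* i) := y :* i :* x) refl x y (y ⁻¹) ⟩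
    y * y ⁻¹ * x     ≈⟨ *-congʳ (⁻¹-inverseʳ y (0<x⇒x≉0 0<y)) ⟩
    1# * x           ≈⟨ *-identityˡ x ⟩
    x                ∎
    where open SetoidReasoning setoid

  *-cancelˡ-≈ : 0# < z → z * x ≈ z * y → x ≈ y
  *-cancelˡ-≈ {z} {x} {y} 0<z zx≈zy = begin
    x            ≈⟨ /-cancel 0<z ⟨
    z * (x / z)  ≈⟨ sym (*-assoc _ _ _) ⟩
    z * x * z ⁻¹ ≈⟨ *-congʳ zx≈zy ⟩
    z * y * z ⁻¹ ≈⟨ *-assoc _ _ _ ⟩
    z * (y / z)  ≈⟨ /-cancel 0<z ⟩
    y            ∎
    where open SetoidReasoning setoid

  *-cancelˡ-nonNegative : 0# < z → 0# ≤ z * x → 0# ≤ x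
  *-cancelˡ-nonNegative {z} {x} 0<z 0≤zx = ≤-respʳ (/-cancel 0<z)
    (≤-respʳ (*-assoc z x (z ⁻¹)) (*-nonNegative 0≤zx (proj₁ (⁻¹-positive 0<z))))

  *-cancelˡ-≤ : 0# < z → z * x ≤ z * y → x ≤ y
  *-cancelˡ-≤ {z} {x} {y} 0<z zx≤zy = 0≤y-x⇒x≤y (*-cancelˡ-nonNegative 0<z
    (≤-respʳ (solve 3 (λ x y z → z :* y :- z :* x := z :* (y :- x)) refl x y z) (x≤y⇒0≤y-x zx≤zy)))

  *-cancelˡ-positive : 0# < z → 0# < z * x → 0# < x
  *-cancelˡ-positive 0<z (0≤zx , 0≉zx) = *-cancelˡ-nonNegative 0<z 0≤zx ,
    λ 0≈x → 0≉zx (trans (sym (zeroʳ _)) (*-congˡ 0≈x))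

  *-mono-≤ : 0# ≤ x → 0# ≤ z → x ≤ y → z ≤ w → x * z ≤ y * w
  *-mono-≤ {x} {z} {y} {w} 0≤x 0≤z x≤y z≤w = ≤-witness
    (+-nonNegative (*-nonNegative (x≤y⇒0≤y-x x≤y) (≤-trans 0≤z z≤w)) (*-nonNegative 0≤x (x≤y⇒0≤y-x z≤w)))
    (solve 4 (λ x y z w → y :* w := x :* z :+ ((y :- x) :* w :+ x :* (w :- z))) refl x y z w)

  -- Totality yields only weak inequalities; excluded middle on x ≈ y supplies the strict one.
  <-or-≥ : ∀ x y → x < y ⊎ y ≤ x
  <-or-≥ x y with total x y
  ... | inj₂ y≤x = inj₂ y≤x
  ... | inj₁ x≤y with em {x ≈ y}
  ...   | yes x≈y = inj₂ (≤-reflexive (sym x≈y))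
  ...   | no  x≉y = inj₁ (x≤y , x≉y)

  square-mono-< : 0# ≤ x → x < y → x * x < y * y
  square-mono-< {x} {y} 0≤x x<y = 0<y-x⇒x<y (<-respʳ
    (solve 2 (λ x y → (y :- x) :* (y :+ x) := y :* y :- x :* x) refl x y)
    (*-positive (x<y⇒0<y-x x<y) (+-positive (≤-<-trans 0≤x x<y) 0≤x)))

  square-cancel-≤ : 0# ≤ y → x * x ≤ y * y → x ≤ y
  square-cancel-≤ {y} {x} 0≤y xx≤yy with <-or-≥ y x
  ... | inj₂ x≤y = x≤y
  ... | inj₁ y<x = contradiction xx≤yy (x<y⇒y≰x (square-mono-< 0≤y y<x))

  square-cancel-< : 0# ≤ y → x * x < y * y → x < y
  square-cancel-< {y} {x} 0≤y xx<yy with <-or-≥ x y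
  ... | inj₁ x<y = x<y
  ... | inj₂ y≤x = contradiction (*-mono-≤ 0≤y 0≤y y≤x y≤x) (x<y⇒y≰x xx<yy)

  -- Square roots as suprema

  module SquareRoot {a : Carrier} (0≤a : 0# ≤ a) where

    Below : Carrier → Set _
    Below x = 0# ≤ x × x * x ≤ a

    -- `a` alone fails as a bound for 0 < a < 1; after adding 1 the square exceeds a in every case.
    bounded : UpperBound Below (a + 1#)
    bounded x (_ , xx≤a) = square-cancel-≤ (+-nonNegative 0≤a 0≤1)
      (≤-trans xx≤a (≤-witness (+-nonNegative (+-nonNegative 0≤a (0≤x*x a)) 0≤1)
        (solve 1 (λ a → (a :+ con (+ 1)) :* (a :+ con (+ 1)) := a :+ (a :+ a :* a :+ con (+ 1))) refl a)))

    0-below : Below 0#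
    0-below = ≤-refl , ≤-respˡ (sym (zeroʳ 0#)) 0≤a

    root : Carrier
    root = proj₁ (supremum Below (0# , 0-below) (a + 1# , bounded))

    root-upper : UpperBound Below root
    root-upper = proj₁ (proj₂ (supremum Below (0# , 0-below) (a + 1# , bounded)))

    root-least : ∀ b → UpperBound Below b → root ≤ b
    root-least = proj₂ (proj₂ (supremum Below (0# , 0-below) (a + 1# , bounded)))

    0≤root : 0# ≤ root
    0≤root = root-upper 0# 0-below

    private
      s = root

    -- If s² < a then s + δ is still below, for δ = (a - s²) / (2s + 1 + (a - s²)).
    a≤root² : a ≤ s * s
    a≤root² with <-or-≥ (s * s) a
    ... | inj₂ a≤ss = a≤ss
    ... | inj₁ ss<a = contradiction (root-upper (s + δ) s+δ-below)
      (x<y⇒y≰x (0<y-x⇒x<y (<-respʳ (solve 2 (λ s δ → δ := s :+ δ :- s) refl s δ) 0<δ)))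
      where
      d = a - s * s
      c = s + s + 1#
      0<d : 0# < d
      0<d = x<y⇒0<y-x ss<a
      0≤c : 0# ≤ c
      0≤c = +-nonNegative (+-nonNegative 0≤root 0≤root) 0≤1
      0<d+c : 0# < d + c
      0<d+c = +-positive 0<d 0≤c
      δ = d / (d + c)
      0<δ : 0# < δ
      0<δ = *-positive 0<d (⁻¹-positive 0<d+c)
      δ≤1 : δ ≤ 1#
      δ≤1 = *-cancelˡ-≤ 0<d+c (≤-resp₂ (sym (/-cancel 0<d+c)) (sym (*-identityʳ _)) (x≤x+y 0≤c))
      s+δ-below : Below (s + δ)
      s+δ-below = +-nonNegative 0≤root (proj₁ 0<δ) , 0≤y-x⇒x≤y
        (≤-respʳ gap (+-nonNegative (*-nonNegative (proj₁ 0<δ) (x≤y⇒0≤y-x δ≤1)) (*-nonNegative (proj₁ 0<δ) (proj₁ 0<d))))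
        where
        open SetoidReasoning setoid
        -- Since δ (d + c) = d and c = 2s + 1, what is left of a after subtracting (s + δ)² is this
        -- sum. The summand d in the denominator of δ keeps δ at most 1.
        gap : δ * (1# - δ) + δ * d ≈ a - (s + δ) * (s + δ)
        gap = begin
          δ * (1# - δ) + δ * d
            ≈⟨ solve 3 (λ a s δ → δ :* (con (+ 1) :- δ) :+ δ :* (a :- s :* s)
                 := (a :- s :* s :+ (s :+ s :+ con (+ 1))) :* δ :- (δ :* δ :+ (s :+ s) :* δ)) refl a s δ ⟩
          (d + c) * δ - (δ * δ + (s + s) * δ)
            ≈⟨ +-congʳ (/-cancel 0<d+c) ⟩
          d - (δ * δ + (s + s) * δ)
            ≈⟨ solve 3 (λ a s δ → a :- s :* s :- (δ :* δ :+ (s :+ s) :* δ)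
                 := a :- (s :+ δ) :* (s :+ δ)) refl a s δ ⟩
          a - (s + δ) * (s + δ) ∎

    -- If a < s² then the Newton iterate (s² + a) / 2s is a smaller upper bound.
    root²≤a : s * s ≤ a
    root²≤a with <-or-≥ a (s * s)
    ... | inj₂ ss≤a = ss≤a
    ... | inj₁ a<ss = contradiction (root-least t t-upper) (x<y⇒y≰x t<s)
      where
      0<ss : 0# < s * s
      0<ss = ≤-<-trans 0≤a a<ss
      0<s : 0# < s
      0<s = 0≤root , λ 0≈s → 0<x⇒x≉0 0<ss (trans (*-congʳ (sym 0≈s)) (zeroˡ s))
      0<2s : 0# < s + s
      0<2s = +-positive 0<s 0≤root
      t = (s * s + a) / (s + s)
      2st : (s + s) * t ≈ s * s + a
      2st = /-cancel 0<2s
      0≤t : 0# ≤ t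
      0≤t = *-nonNegative (+-nonNegative (proj₁ 0<ss) 0≤a) (proj₁ (⁻¹-positive 0<2s))
      t<s : t < s
      t<s = 0<y-x⇒x<y (*-cancelˡ-positive 0<2s (<-respʳ gap (x<y⇒0<y-x a<ss)))
        where
        open SetoidReasoning setoid
        gap : s * s - a ≈ (s + s) * (s - t)
        gap = begin
          s * s - a
            ≈⟨ solve 2 (λ s a → s :* s :- a := (s :+ s) :* s :- (s :* s :+ a)) refl s a ⟩
          (s + s) * s - (s * s + a)
            ≈⟨ +-congˡ (-‿cong 2st) ⟨
          (s + s) * s - (s + s) * t
            ≈⟨ solve 2 (λ s t → (s :+ s) :* s :- (s :+ s) :* t := (s :+ s) :* (s :- t)) refl s t ⟩
          (s + s) * (s - t) ∎
      -- A Newton iterate never undershoots: t² exceeds a by the square of s - t.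
      a≤tt : a ≤ t * t
      a≤tt = ≤-witness (0≤x*x (s - t)) (begin
        t * t                                    ≈⟨ solve 2 (λ s t → t :* t := (s :+ s) :* t :- s :* s :+ (s :- t) :* (s :- t)) refl s t ⟩
        (s + s) * t - s * s + (s - t) * (s - t)  ≈⟨ +-congʳ (+-congʳ 2st) ⟩
        s * s + a - s * s + (s - t) * (s - t)    ≈⟨ +-congʳ (solve 2 (λ s a → s :* s :+ a :- s :* s := a) refl s a) ⟩
        a + (s - t) * (s - t)                    ∎)
        where open SetoidReasoning setoid
      t-upper : UpperBound Below t
      t-upper x (_ , xx≤a) = square-cancel-≤ 0≤t (≤-trans xx≤a a≤tt)

  opaque
    sqrt : 0# ≤ x → ∃ λ s → 0# ≤ s × s * s ≈ x
    sqrt 0≤x = root , 0≤root , antisym root²≤a a≤root²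
      where open SquareRoot 0≤x

-- Quadratic forms on finite-dimensional spaces

module FiniteDimension (em : ExcludedMiddle ℓ) (ℝ : CompleteOrderedField ℓ) where
  open RealField em ℝ public
  open SemiringSum semiring public
    using (sum-remove; sum-cong-≋; ∑-distrib-+; ∑-comm; *-distribˡ-sum; *-distribʳ-sum; sum-replicate; sum-replicate-zero)
  open SetoidReasoning setoid

  Vector : ℕ → Set _
  Vector n = Fin n → Carrier

  Matrix : ℕ → Set _
  Matrix n = Fin n → Vector n

  private variable
    n : ℕ
    u v w : Vector n
    A : Matrix n

  sum-nonNegative : (∀ i → 0# ≤ u i) → 0# ≤ sum u
  sum-nonNegative {zero}  0≤x = ≤-refl
  sum-nonNegative {suc n} 0≤x = +-nonNegative (0≤x zero) (sum-nonNegative (0≤x ∘ suc))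

  sum-mono-≤ : (∀ i → u i ≤ v i) → sum u ≤ sum v
  sum-mono-≤ {zero}  x≤y = ≤-refl
  sum-mono-≤ {suc n} x≤y = +-mono-≤ (x≤y zero) (sum-mono-≤ (x≤y ∘ suc))

  sum-zero : (∀ i → u i ≈ 0#) → sum u ≈ 0#
  sum-zero {n} x≈0 = trans (sum-cong-≋ x≈0) (sum-replicate-zero n)

  sum-single : ∀ i → (∀ j → j ≢ i → u j ≈ 0#) → sum u ≈ u i
  sum-single {suc n} {u = x} i x≈0 = begin
    sum x                     ≈⟨ sum-remove x ⟩
    x i + sum (removeAt x i)  ≈⟨ +-congˡ (sum-zero (λ j → x≈0 _ (punchInᵢ≢i i j))) ⟩
    x i + 0#                  ≈⟨ +-identityʳ _ ⟩
    x i                       ∎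

  sum-nonNegative-zero : (∀ i → 0# ≤ u i) → sum u ≤ 0# → ∀ i → u i ≈ 0#
  sum-nonNegative-zero {suc n} {u = x} 0≤x s≤0 i = antisym
    (≤-trans (x≤x+y (sum-nonNegative (λ j → 0≤x (punchIn i j)))) (≤-respˡ (sum-remove x) s≤0))
    (0≤x i)

  dot : Vector n → Vector n → Carrier
  dot x y = sum (λ i → x i * y i)

  mul : Matrix n → Vector n → Vector n
  mul A x i = dot (A i) x

  quad : Matrix n → Vector n → Carrier
  quad A x = dot x (mul A x)

  IsSymmetric : Matrix n → Set _
  IsSymmetric A = ∀ i j → A i j ≈ A j i

  NonZero : Vector n → Set _
  NonZero x = ¬ (∀ i → x i ≈ 0#)

  dot-congʳ : (∀ i → v i ≈ w i) → dot u v ≈ dot u w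
  dot-congʳ y≈z = sum-cong-≋ (λ i → *-congˡ (y≈z i))

  dot-comm : ∀ (x y : Vector n) → dot x y ≈ dot y x
  dot-comm x y = sum-cong-≋ (λ i → *-comm (x i) (y i))

  sum-linear : ∀ c d (x y : Vector n) → sum (λ i → c * x i + d * y i) ≈ c * sum x + d * sum y
  sum-linear c d x y = trans (∑-distrib-+ (λ i → c * x i) (λ i → d * y i))
    (sym (+-cong (*-distribˡ-sum c x) (*-distribˡ-sum d y)))

  dot-linearʳ : ∀ c d (x y z : Vector n) →
                dot x (λ i → c * y i + d * z i) ≈ c * dot x y + d * dot x z
  dot-linearʳ c d x y z = trans
    (sum-cong-≋ (λ i → solve 5 (λ c d x y z → x :* (c :* y :+ d :* z) := c :* (x :* y) :+ d :* (x :* z))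
      refl c d (x i) (y i) (z i)))
    (sum-linear c d (λ i → x i * y i) (λ i → x i * z i))

  dot-linearˡ : ∀ c d (x y z : Vector n) →
                dot (λ i → c * x i + d * y i) z ≈ c * dot x z + d * dot y z
  dot-linearˡ c d x y z = trans (dot-comm _ z)
    (trans (dot-linearʳ c d z x y) (+-cong (*-congˡ (dot-comm z x)) (*-congˡ (dot-comm z y))))

  dot-self-adjoint : IsSymmetric A → ∀ x y → dot x (mul A y) ≈ dot y (mul A x)
  dot-self-adjoint {A = A} A-sym x y = begin
    sum (λ i → x i * sum (λ j → A i j * y j))    ≈⟨ sum-cong-≋ (λ i → *-distribˡ-sum (x i) (λ j → A i j * y j)) ⟩
    sum (λ i → sum (λ j → x i * (A i j * y j)))  ≈⟨ ∑-comm (λ i j → x i * (A i j * y j)) ⟩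
    sum (λ j → sum (λ i → x i * (A i j * y j)))  ≈⟨ sum-cong-≋ (λ j → sum-cong-≋ (λ i → swap i j)) ⟩
    sum (λ j → sum (λ i → y j * (A j i * x i)))  ≈⟨ sum-cong-≋ (λ j → *-distribˡ-sum (y j) (λ i → A j i * x i)) ⟨
    sum (λ j → y j * sum (λ i → A j i * x i))    ∎
    where
    swap : ∀ i j → x i * (A i j * y j) ≈ y j * (A j i * x i)
    swap i j = trans (*-congˡ (*-congʳ (A-sym i j)))
      (solve 3 (λ x a y → x :* (a :* y) := y :* (a :* x)) refl (x i) (A j i) (y j))

  quad-combination : IsSymmetric A → ∀ c d x y →
    quad A (λ i → c * x i + d * y i) ≈
    c * c * quad A x + (c * d + c * d) * dot y (mul A x) + d * d * quad A y
  quad-combination {A = A} A-sym c d x y = begin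
    dot s (mul A s)
      ≈⟨ dot-congʳ (λ i → dot-linearʳ c d (A i) x y) ⟩
    dot s (λ i → c * mul A x i + d * mul A y i)
      ≈⟨ dot-linearʳ c d s (mul A x) (mul A y) ⟩
    c * dot s (mul A x) + d * dot s (mul A y)
      ≈⟨ +-cong (*-congˡ (dot-linearˡ c d x y _)) (*-congˡ (dot-linearˡ c d x y _)) ⟩
    c * (c * quad A x + d * dot y (mul A x)) + d * (c * dot x (mul A y) + d * quad A y)
      ≈⟨ +-congˡ (*-congˡ (+-congʳ (*-congˡ (dot-self-adjoint A-sym x y)))) ⟩
    c * (c * quad A x + d * dot y (mul A x)) + d * (c * dot y (mul A x) + d * quad A y)
      ≈⟨ solve 5 (λ c d p q r → c :* (c :* p :+ d :* q) :+ d :* (c :* q :+ d :* r)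
           := c :* c :* p :+ (c :* d :+ c :* d) :* q :+ d :* d :* r) refl c d (quad A x) (dot y (mul A x)) (quad A y) ⟩
    c * c * quad A x + (c * d + c * d) * dot y (mul A x) + d * d * quad A y ∎
    where s = λ i → c * x i + d * y i

  0≤dot : ∀ (x : Vector n) → 0# ≤ dot x x
  0≤dot x = sum-nonNegative (λ i → 0≤x*x (x i))

  x*x≈0⇒x≈0 : ∀ {a} → a * a ≈ 0# → a ≈ 0#
  x*x≈0⇒x≈0 {a} aa≈0 with em {a ≈ 0#}
  ... | yes a≈0 = a≈0
  ... | no  a≉0 = x*y≈0⇒y≈0 a≉0 aa≈0

  dot≤0⇒≈0 : ∀ (x : Vector n) → dot x x ≤ 0# → ∀ i → x i ≈ 0#
  dot≤0⇒≈0 x xx≤0 i = x*x≈0⇒x≈0 (sum-nonNegative-zero (λ i → 0≤x*x (x i)) xx≤0 i)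

  0<dot : NonZero u → 0# < dot u u
  0<dot {u = x} x≉0 with <-or-≥ 0# (dot x x)
  ... | inj₁ 0<xx = 0<xx
  ... | inj₂ xx≤0 = contradiction (dot≤0⇒≈0 x xx≤0) x≉0

  -- With N = ⟨Ax,Ax⟩ and c = ⟨Ax,A(Ax)⟩ + 1, the form takes at c x - N Ax the
  -- value - N² (c + 1).
  isotropic⇒kernel : IsSymmetric A → (∀ y → 0# ≤ quad A y) →
                     ∀ x → quad A x ≈ 0# → ∀ i → mul A x i ≈ 0#
  isotropic⇒kernel {A = A} A-sym 0≤A x Ax≈0 = dot≤0⇒≈0 y (≤-reflexive (x*x≈0⇒x≈0 NN≈0))
    where
    y = mul A x
    N = dot y y
    p = quad A y
    c = p + 1#
    0<c+1 : 0# < c + 1#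
    0<c+1 = <-respʳ (+-comm _ _) (+-positive 0<1 (+-nonNegative (0≤A y) 0≤1))
    value : quad A (λ i → c * x i + - N * y i) ≈ (c + 1#) * - (N * N)
    value = begin
      quad A (λ i → c * x i + - N * y i)
        ≈⟨ quad-combination A-sym c (- N) x y ⟩
      c * c * quad A x + (c * - N + c * - N) * N + - N * - N * p
        ≈⟨ +-congʳ (+-congʳ (trans (*-congˡ Ax≈0) (zeroʳ _))) ⟩
      0# + (c * - N + c * - N) * N + - N * - N * p
        ≈⟨ solve 2 (λ p N → con (+ 0) :+ ((p :+ con (+ 1)) :* (:- N) :+ (p :+ con (+ 1)) :* (:- N)) :* N :+ (:- N) :* (:- N) :* p
             := (p :+ con (+ 1) :+ con (+ 1)) :* (:- (N :* N))) refl p N ⟩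
      (c + 1#) * - (N * N) ∎
    0≤-NN : 0# ≤ - (N * N)
    0≤-NN = *-cancelˡ-nonNegative 0<c+1 (≤-respʳ value (0≤A _))
    NN≈0 : N * N ≈ 0#
    NN≈0 = antisym (≤-resp₂ (+-identityʳ _) (-‿inverseʳ _) (+-monoʳ-≤ (N * N) 0≤-NN)) (0≤x*x N)

  -- A crude Cauchy-Schwarz inequality. Any constant will do, and (u + v)² ≤ 2u² + 2v², applied one
  -- coordinate at a time, provides one.
  functional-bounded : ∀ (b : Vector n) → ∃ λ K → 0# ≤ K × (∀ x → dot b x * dot b x ≤ K * dot x x)
  functional-bounded {zero}  b = 0# , ≤-refl , λ _ → ≤-refl
  functional-bounded {suc n} b with functional-bounded (b ∘ suc)
  ... | K , 0≤K , bounded = K + K + (b₀ * b₀ + b₀ * b₀) , 0≤K′ , λ x → ≤-witness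
    (gap-nonNegative x)
    (solve 5 (λ b₀ x₀ β K N → (K :+ K :+ (b₀ :* b₀ :+ b₀ :* b₀)) :* (x₀ :* x₀ :+ N)
        := (b₀ :* x₀ :+ β) :* (b₀ :* x₀ :+ β)
        :+ ((b₀ :* x₀ :- β) :* (b₀ :* x₀ :- β) :+ (K :* N :- β :* β) :+ (K :* N :- β :* β)
        :+ (K :+ K) :* (x₀ :* x₀) :+ (b₀ :* b₀ :+ b₀ :* b₀) :* N))
      refl b₀ (x zero) (dot (b ∘ suc) (x ∘ suc)) K (dot (x ∘ suc) (x ∘ suc)))
    where
    b₀ = b zero
    0≤2K = +-nonNegative 0≤K 0≤K
    0≤2bb = +-nonNegative (0≤x*x b₀) (0≤x*x b₀)
    0≤K′ = +-nonNegative 0≤2K 0≤2bb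
    gap-nonNegative : ∀ x → _
    gap-nonNegative x = +-nonNegative (+-nonNegative (+-nonNegative (+-nonNegative
      (0≤x*x (b₀ * x zero - dot (b ∘ suc) (x ∘ suc)))
      (x≤y⇒0≤y-x (bounded (x ∘ suc)))) (x≤y⇒0≤y-x (bounded (x ∘ suc))))
      (*-nonNegative 0≤2K (0≤x*x (x zero)))) (*-nonNegative 0≤2bb (0≤dot (x ∘ suc)))

  matrix-bounded : ∀ {m} (A : Fin m → Vector n) →
    ∃ λ K → ∀ x → sum (λ i → dot (A i) x * dot (A i) x) ≤ K * dot x x
  matrix-bounded A = sum K , λ x → ≤-respʳ (sym (*-distribʳ-sum (dot x x) K))
    (sum-mono-≤ (λ i → proj₂ (proj₂ (functional-bounded (A i))) x))
    where
    K = λ i → proj₁ (functional-bounded (A i))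

  -- From a² + ab + b² ≥ 0 in each coordinate, the form is at least - ⟨x,x⟩ - ⟨Ax,Ax⟩. This makes
  -- the set of form bounds nonempty, as its supremum requires.
  quad-bounded-below : ∀ (A : Matrix n) → ∃ λ c → ∀ x → c * dot x x ≤ quad A x
  quad-bounded-below A with matrix-bounded A
  ... | K , bounded = - (1# + K) , λ x → ≤-witness
    (+-nonNegative (x≤y⇒0≤y-x (bounded x)) (sum-nonNegative (λ i → 0≤xx+xy+yy (x i) (mul A x i))))
    (begin
      quad A x
        ≈⟨ solve 4 (λ K p q r → q := (:- (con (+ 1) :+ K)) :* p :+ ((K :* p :- r) :+ (p :+ q :+ r)))
             refl K (dot x x) (quad A x) (dot (mul A x) (mul A x)) ⟩
      - (1# + K) * dot x x + ((K * dot x x - dot (mul A x) (mul A x))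
        + (dot x x + quad A x + dot (mul A x) (mul A x)))
        ≈⟨ +-congˡ (+-congˡ (trans (∑-distrib-+ (λ i → x i * x i + x i * mul A x i) (λ i → mul A x i * mul A x i))
             (+-congʳ (∑-distrib-+ (λ i → x i * x i) (λ i → x i * mul A x i))))) ⟨
      - (1# + K) * dot x x + ((K * dot x x - dot (mul A x) (mul A x))
        + sum (λ i → x i * x i + x i * mul A x i + mul A x i * mul A x i)) ∎)
    where
    0≤xx+xy+yy : ∀ a b → 0# ≤ a * a + a * b + b * b
    0≤xx+xy+yy a b = *-cancelˡ-nonNegative {fromℕ 4} (fromℕ-positive {4} (ℕ.s≤s ℕ.z≤n)) (≤-respʳ
      (solve 2 (λ a b → (a :+ a :+ b) :* (a :+ a :+ b) :+ con (+ 3) :* (b :* b)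
          := con (+ 4) :* (a :* a :+ a :* b :+ b :* b)) refl a b)
      (+-nonNegative (0≤x*x _) (*-nonNegative (fromℕ-nonNegative 3) (0≤x*x b))))

  -- The Schur complement of the top left entry, multiplied by that entry.
  schur : Matrix (suc n) → Matrix n
  schur A i j = A zero zero * A (suc i) (suc j) + - A zero (suc i) * A zero (suc j)

  schur-sym : IsSymmetric A → IsSymmetric (schur A)
  schur-sym {A = A} A-sym i j = +-cong (*-congˡ (A-sym (suc i) (suc j)))
    (solve 2 (λ b c → (:- b) :* c := (:- c) :* b) refl (A zero (suc i)) (A zero (suc j)))

  -- Scaling the form by its corner a avoids division: the usual a (x₀ + β/a)² turns into (a x₀ +
  -- β)², and the Schur complement stays polynomial in the entries.
  complete-square : IsSymmetric A → ∀ x →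
    let a = A zero zero
        u = a * x zero + dot (λ j → A zero (suc j)) (x ∘ suc)
    in a * quad A x ≈ u * u + quad (schur A) (x ∘ suc)
  complete-square {A = A} A-sym x = begin
    a * (t * (a * t + β) + sum (λ i → y i * (A (suc i) zero * t + m i)))
      ≈⟨ *-congˡ (+-congˡ (sum-cong-≋ (λ i → row i))) ⟩
    a * (t * (a * t + β) + sum (λ i → t * (b i * y i) + 1# * (y i * m i)))
      ≈⟨ *-congˡ (+-congˡ (sum-linear t 1# (λ i → b i * y i) (λ i → y i * m i))) ⟩
    a * (t * (a * t + β) + (t * β + 1# * q))
      ≈⟨ solve 4 (λ a t β q → a :* (t :* (a :* t :+ β) :+ (t :* β :+ con (+ 1) :* q))
           := (a :* t :+ β) :* (a :* t :+ β) :+ (a :* q :+ (:- β) :* β)) refl a t β q ⟩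
    (a * t + β) * (a * t + β) + (a * q + - β * β)
      ≈⟨ +-congˡ (+-congˡ (*-congˡ (dot-comm b y))) ⟩
    (a * t + β) * (a * t + β) + (a * q + - β * dot y b)
      ≈⟨ +-congˡ (dot-linearʳ a (- β) y m b) ⟨
    (a * t + β) * (a * t + β) + dot y (λ i → a * m i + - β * b i)
      ≈⟨ +-congˡ (dot-congʳ (λ i → +-congˡ (solve 2 (λ β b → (:- β) :* b := (:- b) :* β) refl β (b i)))) ⟩
    (a * t + β) * (a * t + β) + dot y (λ i → a * m i + - b i * β)
      ≈⟨ +-congˡ (dot-congʳ (λ i → dot-linearˡ a (- b i) (λ j → A (suc i) (suc j)) b y)) ⟨
    (a * t + β) * (a * t + β) + quad (schur A) y ∎
    where
    a = A zero zero
    t = x zero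
    y = x ∘ suc
    b = λ j → A zero (suc j)
    β = dot b y
    m = mul (λ i j → A (suc i) (suc j)) y
    q = dot y m
    row : ∀ i → y i * (A (suc i) zero * t + m i) ≈ t * (b i * y i) + 1# * (y i * m i)
    row i = trans (*-congˡ (+-congʳ (*-congʳ (A-sym (suc i) zero))))
      (solve 4 (λ y b t m → y :* (b :* t :+ m) := t :* (b :* y) :+ con (+ 1) :* (y :* m)) refl (y i) (b i) t (m i))

  corner-positive : ∀ (A : Matrix (suc n)) → (∀ x → NonZero x → 0# < quad A x) → 0# < A zero zero
  corner-positive A 0<A = <-respʳ
    (begin
      1# * (a * 1# + dot (λ j → A zero (suc j)) (λ _ → 0#)) + sum (λ i → 0# * mul A e (suc i))
        ≈⟨ +-cong (*-congˡ (+-congˡ (sum-zero (λ j → zeroʳ (A zero (suc j)))))) (sum-zero (λ i → zeroˡ (mul A e (suc i)))) ⟩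
      1# * (a * 1# + 0#) + 0#
        ≈⟨ solve 1 (λ a → con (+ 1) :* (a :* con (+ 1) :+ con (+ 0)) :+ con (+ 0) := a) refl a ⟩
      a ∎)
    (0<A e (λ e≈0 → 1≉0 (e≈0 zero)))
    where
    a = A zero zero
    e = 1# ∷ λ _ → 0#

  schur-positive : IsSymmetric A → (∀ x → NonZero x → 0# < quad A x) →
                   ∀ y → NonZero y → 0# < quad (schur A) y
  schur-positive {A = A} A-sym 0<A y y≉0 = <-respʳ
    (begin
      a * quad A (t ∷ y)
        ≈⟨ complete-square A-sym (t ∷ y) ⟩
      (a * t + β) * (a * t + β) + quad (schur A) y
        ≈⟨ +-congʳ (*-cong at+β≈0 at+β≈0) ⟩
      0# * 0# + quad (schur A) y
        ≈⟨ solve 1 (λ q → con (+ 0) :* con (+ 0) :+ q := q) refl (quad (schur A) y) ⟩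
      quad (schur A) y ∎)
    (*-positive 0<a (0<A (t ∷ y) (λ ty≈0 → y≉0 (ty≈0 ∘ suc))))
    where
    a = A zero zero
    0<a : 0# < a
    0<a = corner-positive A 0<A
    β = dot (λ j → A zero (suc j)) y
    -- Chosen to make the completed square vanish, so that only the Schur complement remains.
    t = (- β) / a
    at+β≈0 : a * t + β ≈ 0#
    at+β≈0 = trans (+-congʳ (/-cancel 0<a)) (-‿inverseˡ β)

  -- With s = a t + β, the identity a t = s - β gives a² t² ≤ 2s² + 2β². Adding a² N and using β² ≤
  -- K N bounds a² (t² + N) by 2s² + L N. After multiplication by ε, the term ε L N is at most L q,
  -- and the factor 2ε + L absorbs everything.
  coercive-extend : ∀ {a K ε q N β t} → let L = (K + K) + a * a in
    0# ≤ ε → 0# ≤ L → 0# ≤ q → β * β ≤ K * N → ε * N ≤ q →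
    ε * (a * a * (t * t + N)) ≤ ((ε + ε) + L) * ((a * t + β) * (a * t + β) + q)
  coercive-extend {a} {K} {ε} {q} {N} {β} {t} 0≤ε 0≤L 0≤q ββ≤KN εN≤q =
    ≤-trans (*-monoˡ-≤ 0≤ε step₁) step₂
    where
    L = (K + K) + a * a
    s = a * t + β
    step₁ : a * a * (t * t + N) ≤ (s * s + s * s) + L * N
    step₁ = ≤-witness
      (+-nonNegative (+-nonNegative (x≤y⇒0≤y-x ββ≤KN) (x≤y⇒0≤y-x ββ≤KN)) (0≤x*x (s + β)))
      (solve 5 (λ a t β K N → let s = a :* t :+ β in
        (s :* s :+ s :* s) :+ ((K :+ K) :+ a :* a) :* N
        := a :* a :* (t :* t :+ N) :+ ((K :* N :- β :* β) :+ (K :* N :- β :* β) :+ (s :+ β) :* (s :+ β)))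
        refl a t β K N)
    step₂ : ε * ((s * s + s * s) + L * N) ≤ ((ε + ε) + L) * (s * s + q)
    step₂ = ≤-witness
      (+-nonNegative (+-nonNegative (*-nonNegative 0≤L (x≤y⇒0≤y-x εN≤q)) (*-nonNegative 0≤L (0≤x*x s)))
        (*-nonNegative (+-nonNegative 0≤ε 0≤ε) 0≤q))
      (solve 5 (λ ε s L N q → ((ε :+ ε) :+ L) :* (s :+ q)
        := ε :* ((s :+ s) :+ L :* N) :+ (L :* (q :- ε :* N) :+ L :* s :+ (ε :+ ε) :* q))
        refl ε (s * s) L N q)

  -- The uniform margin ε, absent from mere positivity at nonzero vectors, is what allows a form
  -- bound to be raised.
  IsCoercive : Matrix n → Set _
  IsCoercive A = ∃ λ ε → 0# < ε × (∀ x → ε * dot x x ≤ quad A x)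

  schur-coercive : ∀ (A : Matrix (suc n)) → IsSymmetric A → 0# < A zero zero →
                   IsCoercive (schur A) → IsCoercive A
  schur-coercive A A-sym 0<a (ε , 0<ε , coercive) = ε′ , 0<ε′ , bound
    where
    a = A zero zero
    bounded = functional-bounded (λ j → A zero (suc j))
    K = proj₁ bounded
    L = (K + K) + a * a
    0≤L : 0# ≤ L
    0≤L = +-nonNegative (+-nonNegative (proj₁ (proj₂ bounded)) (proj₁ (proj₂ bounded))) (0≤x*x a)
    D = (ε + ε) + L
    0<D : 0# < D
    0<D = +-positive (+-positive 0<ε (proj₁ 0<ε)) 0≤L
    -- `coercive-extend` yields ε a² ⟨x,x⟩ ≤ D a ⟨x,Ax⟩; dividing by a D leaves this constant.
    ε′ = (a * ε) / D
    0<ε′ : 0# < ε′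
    0<ε′ = *-positive (*-positive 0<a 0<ε) (⁻¹-positive 0<D)
    bound : ∀ x → ε′ * dot x x ≤ quad A x
    bound x = *-cancelˡ-≤ (*-positive 0<a 0<D) (≤-resp₂ lhs rhs
      (coercive-extend {a} {K} {ε} {quad (schur A) y} {dot y y} {β} {x zero} (proj₁ 0<ε) 0≤L
        (≤-trans (*-nonNegative (proj₁ 0<ε) (0≤dot y)) (coercive y)) (proj₂ (proj₂ bounded) y) (coercive y)))
      where
      y = x ∘ suc
      β = dot (λ j → A zero (suc j)) y
      s = a * x zero + β
      lhs : ε * (a * a * dot x x) ≈ a * D * (ε′ * dot x x)
      lhs = begin
        ε * (a * a * dot x x)     ≈⟨ solve 3 (λ ε a n → ε :* (a :* a :* n) := a :* (a :* ε) :* n) refl ε a (dot x x) ⟩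
        a * (a * ε) * dot x x     ≈⟨ *-congʳ (*-congˡ (/-cancel 0<D)) ⟨
        a * (D * ε′) * dot x x    ≈⟨ solve 4 (λ a D e n → a :* (D :* e) :* n := a :* D :* (e :* n)) refl a D ε′ (dot x x) ⟩
        a * D * (ε′ * dot x x)    ∎
      rhs : D * (s * s + quad (schur A) y) ≈ a * D * quad A x
      rhs = begin
        D * (s * s + quad (schur A) y)  ≈⟨ *-congˡ (complete-square A-sym x) ⟨
        D * (a * quad A x)              ≈⟨ solve 3 (λ a D Q → D :* (a :* Q) := a :* D :* Q) refl a D (quad A x) ⟩
        a * D * quad A x                ∎

  -- Induction on the dimension through Schur complements replaces the compactness of the unit
  -- sphere.
  positive-definite⇒coercive : ∀ n (A : Matrix n) → IsSymmetric A →
    (∀ x → NonZero x → 0# < quad A x) → IsCoercive A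
  positive-definite⇒coercive zero    A A-sym 0<A = 1# , 0<1 , λ x → ≤-reflexive (zeroʳ 1#)
  positive-definite⇒coercive (suc n) A A-sym 0<A = schur-coercive A A-sym (corner-positive A 0<A)
    (positive-definite⇒coercive n (schur A) (schur-sym A-sym) (schur-positive A-sym 0<A))

  identity : Matrix n
  identity i j = if does (i ≟ j) then 1# else 0#

  mul-identity : ∀ (x : Vector n) i → mul identity x i ≈ x i
  mul-identity x i = begin
    sum (λ j → identity i j * x j) ≈⟨ sum-single i (λ j j≢i → trans (*-congʳ (off j j≢i)) (zeroˡ _)) ⟩
    identity i i * x i             ≈⟨ *-congʳ on ⟩
    1# * x i                       ≈⟨ *-identityˡ _ ⟩
    x i                            ∎
    where
    off : ∀ j → j ≢ i → identity i j ≈ 0#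
    off j j≢i rewrite dec-false (i ≟ j) (j≢i ∘ ≡.sym) = refl
    on : identity i i ≈ 1#
    on rewrite dec-true (i ≟ i) ≡.refl = refl

  identity-sym : IsSymmetric (identity {n})
  identity-sym i j with i ≟ j | j ≟ i
  ... | yes _   | yes _   = refl
  ... | no  _   | no  _   = refl
  ... | yes i≡j | no  j≢i = contradiction (≡.sym i≡j) j≢i
  ... | no  i≢j | yes j≡i = contradiction (≡.sym j≡i) i≢j

  quad-identity : ∀ (x : Vector n) → quad identity x ≈ dot x x
  quad-identity x = dot-congʳ (mul-identity x)

  ones : Vector n
  ones _ = 1#

  dot-constant : ∀ (x : Vector n) c → dot x (λ _ → c) ≈ c * sum x
  dot-constant x c = trans (sum-cong-≋ (λ i → *-comm (x i) c)) (sym (*-distribˡ-sum c x))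

  sum-constant : ∀ n c → sum {n} (λ _ → c) ≈ fromℕ n * c
  sum-constant n c = trans (sum-replicate n)
    (trans (×-congʳ n (sym (*-identityˡ c))) (sym (×-assoc-* n 1# c)))

  -- Evaluate the form at n x - (Σ x) 𝟏.
  mean-bound : IsSymmetric A → (∀ y → 0# ≤ quad A y) → ∀ {k} → (∀ i → mul A ones i ≈ k) →
               0# < fromℕ n → ∀ (x : Vector n) → k * (sum x * sum x) ≤ fromℕ n * quad A x
  mean-bound {n} {A = A} A-sym 0≤A {k} A𝟏≈k 0<n x = 0≤y-x⇒x≤y (*-cancelˡ-nonNegative 0<n
    (≤-respʳ value (0≤A (λ i → fromℕ n * x i + - T * ones i))))
    where
    T = sum x
    A𝟏 : dot ones (mul A x) ≈ k * T
    A𝟏 = trans (dot-self-adjoint A-sym ones x) (trans (dot-congʳ A𝟏≈k) (dot-constant x k))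
    𝟏A𝟏 : quad A ones ≈ k * (fromℕ n * 1#)
    𝟏A𝟏 = trans (dot-congʳ A𝟏≈k) (trans (dot-constant {n} ones k) (*-congˡ (sum-constant n 1#)))
    value : quad A (λ i → fromℕ n * x i + - T * ones i) ≈ fromℕ n * (fromℕ n * quad A x - k * (T * T))
    value = begin
      quad A (λ i → fromℕ n * x i + - T * ones i)
        ≈⟨ quad-combination A-sym (fromℕ n) (- T) x ones ⟩
      fromℕ n * fromℕ n * quad A x + (fromℕ n * - T + fromℕ n * - T) * dot ones (mul A x) + - T * - T * quad A ones
        ≈⟨ +-cong (+-congˡ (*-congˡ A𝟏)) (*-congˡ 𝟏A𝟏) ⟩
      fromℕ n * fromℕ n * quad A x + (fromℕ n * - T + fromℕ n * - T) * (k * T) + - T * - T * (k * (fromℕ n * 1#))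
        ≈⟨ solve 4 (λ n q T k → n :* n :* q :+ (n :* (:- T) :+ n :* (:- T)) :* (k :* T) :+ (:- T) :* (:- T) :* (k :* (n :* con (+ 1)))
             := n :* (n :* q :- k :* (T :* T))) refl (fromℕ n) (quad A x) T k ⟩
      fromℕ n * (fromℕ n * quad A x - k * (T * T)) ∎

  -- Eigenvalues from extremal form bounds

  IsEigenvector : Matrix n → Carrier → Vector n → Set _
  IsEigenvector A μ x = NonZero x × (∀ i → mul A x i ≈ μ * x i)

  -- The factor `1#` gives each entry the shape c x + d y to which `dot-linearˡ` applies.
  shift : Matrix n → Carrier → Matrix n
  shift A c i j = 1# * A i j + - c * identity i j

  mul-shift : ∀ (A : Matrix n) c x i → mul (shift A c) x i ≈ mul A x i - c * x i
  mul-shift A c x i = begin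
    dot (shift A c i) x                         ≈⟨ dot-linearˡ 1# (- c) (A i) (identity i) x ⟩
    1# * mul A x i + - c * mul identity x i     ≈⟨ +-cong (*-identityˡ _) (*-congˡ (mul-identity x i)) ⟩
    mul A x i + - c * x i                       ≈⟨ +-congˡ (-‿distribˡ-* c (x i)) ⟨
    mul A x i - c * x i                         ∎

  quad-shift : ∀ (A : Matrix n) c x → quad (shift A c) x ≈ quad A x - c * dot x x
  quad-shift A c x = begin
    dot x (mul (shift A c) x)                 ≈⟨ dot-congʳ (mul-shift A c x) ⟩
    dot x (λ i → mul A x i - c * x i)         ≈⟨ dot-congʳ (λ i → solve 3 (λ m c x → m :- c :* x := con (+ 1) :* m :+ (:- c) :* x) refl (mul A x i) c (x i)) ⟩
    dot x (λ i → 1# * mul A x i + - c * x i)  ≈⟨ dot-linearʳ 1# (- c) x (mul A x) x ⟩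
    1# * quad A x + - c * dot x x             ≈⟨ solve 3 (λ q c n → con (+ 1) :* q :+ (:- c) :* n := q :- c :* n) refl (quad A x) c (dot x x) ⟩
    quad A x - c * dot x x                    ∎

  shift-sym : IsSymmetric A → ∀ c → IsSymmetric (shift A c)
  shift-sym A-sym c i j = +-cong (*-congˡ (A-sym i j)) (*-congˡ (identity-sym i j))

  positive⇒singular⊎coercive : IsSymmetric A → (∀ x → 0# ≤ quad A x) →
    (∃ λ x → NonZero x × (∀ i → mul A x i ≈ 0#)) ⊎ IsCoercive A
  positive⇒singular⊎coercive {A = A} A-sym 0≤A with em {∃ λ x → NonZero x × quad A x ≈ 0#}
  ... | yes (x , x≉0 , Ax≈0) = inj₁ (x , x≉0 , isotropic⇒kernel A-sym 0≤A x Ax≈0)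
  ... | no anisotropic       = inj₂ (positive-definite⇒coercive _ A A-sym
    (λ x x≉0 → 0≤A x , λ 0≈Ax → anisotropic (x , x≉0 , sym 0≈Ax)))

  IsFormBound : Matrix n → Carrier → Set _
  IsFormBound A c = ∀ x → c * dot x x ≤ quad A x

  largest-bound-eigenvalue : IsSymmetric A → ∀ c → IsFormBound A c →
    (∀ b → IsFormBound A b → b ≤ c) → ∃ (IsEigenvector A c)
  largest-bound-eigenvalue {A = A} A-sym c c-bound c-largest =
    [ (λ (x , x≉0 , Bx≈0) → x , x≉0 , eigen x Bx≈0)
    , (λ (ε , 0<ε , coercive) → contradiction (c-largest (c + ε) (increased ε coercive))
        (x<y⇒y≰x (0<y-x⇒x<y (<-respʳ (solve 2 (λ c ε → ε := c :+ ε :- c) refl c ε) 0<ε))))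
    ]′ (positive⇒singular⊎coercive (shift-sym A-sym c) 0≤B)
    where
    B = shift A c

    0≤B : ∀ x → 0# ≤ quad B x
    0≤B x = ≤-respʳ (sym (quad-shift A c x)) (x≤y⇒0≤y-x (c-bound x))

    eigen : ∀ x → (∀ i → mul B x i ≈ 0#) → ∀ i → mul A x i ≈ c * x i
    eigen x Bx≈0 i = begin
      mul A x i                          ≈⟨ solve 2 (λ m d → m := (m :- d) :+ d) refl (mul A x i) (c * x i) ⟩
      (mul A x i - c * x i) + c * x i    ≈⟨ +-congʳ (mul-shift A c x i) ⟨
      mul B x i + c * x i                ≈⟨ +-congʳ (Bx≈0 i) ⟩
      0# + c * x i                       ≈⟨ +-identityˡ _ ⟩
      c * x i                            ∎

    increased : ∀ ε → (∀ x → ε * dot x x ≤ quad B x) → IsFormBound A (c + ε)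
    increased ε coercive x = ≤-witness (x≤y⇒0≤y-x (coercive x)) (begin
      quad A x
        ≈⟨ solve 4 (λ q c ε n → q := (c :+ ε) :* n :+ ((q :- c :* n) :- ε :* n)) refl (quad A x) c ε (dot x x) ⟩
      (c + ε) * dot x x + ((quad A x - c * dot x x) - ε * dot x x)
        ≈⟨ +-congˡ (+-congʳ (quad-shift A c x)) ⟨
      (c + ε) * dot x x + (quad B x - ε * dot x x) ∎)

  *-cancelʳ-≤-/ : ∀ {a b c} → 0# < b → c * b ≤ a → c ≤ a / b
  *-cancelʳ-≤-/ 0<b cb≤a = *-cancelˡ-≤ 0<b (≤-resp₂ (*-comm _ _) (sym (/-cancel 0<b)) cb≤a)

  -- The Rayleigh quotient of any nonzero vector lies above all form bounds. That of w makes the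
  -- supremum exist; those of the other vectors show that the supremum is itself a form bound.
  largest-form-bound : ∀ (A : Matrix n) {w} → NonZero w →
    ∃ λ c → IsFormBound A c × (∀ b → IsFormBound A b → b ≤ c)
  largest-form-bound A {w} w≉0 = attain (supremum (IsFormBound A) (quad-bounded-below A)
    (quad A w / dot w w , λ c bound → *-cancelʳ-≤-/ (0<dot w≉0) (bound w)))
    where
    attain : (∃ λ c → UpperBound (IsFormBound A) c × (∀ b → UpperBound (IsFormBound A) b → c ≤ b)) →
             ∃ λ c → IsFormBound A c × (∀ b → IsFormBound A b → b ≤ c)
    attain (c , upper , least) = c , bound , upper
      where
      bound : IsFormBound A c
      bound x with em {∀ i → x i ≈ 0#}
      ... | yes x≈0 = ≤-reflexive (trans
        (trans (*-congˡ (sum-zero (λ i → trans (*-congʳ (x≈0 i)) (zeroˡ (x i))))) (zeroʳ c))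
        (sym (sum-zero (λ i → trans (*-congʳ (x≈0 i)) (zeroˡ (mul A x i))))))
      ... | no x≉0 = ≤-resp₂ (*-comm _ _) (/-cancel (0<dot x≉0))
        (*-monoˡ-≤ (0≤dot x) (least (quad A x / dot x x)
          (λ b b-bound → *-cancelʳ-≤-/ (0<dot x≉0) (b-bound x))))

  -- The largest c with c ⟨x,x⟩ ≤ ⟨x,Ax⟩ for all x is an eigenvalue: otherwise A - c
  -- would be positive definite and c could be increased.
  least-eigenvalue-bound : IsSymmetric A → ∀ {μ w} → IsEigenvector A μ w →
    (∀ ν x → IsEigenvector A ν x → μ ≤ ν) → ∀ x → μ * dot x x ≤ quad A x
  least-eigenvalue-bound {A = A} A-sym {μ} (w≉0 , _) μ-least x =
    conclude (largest-form-bound A w≉0)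
    where
    conclude : (∃ λ c → IsFormBound A c × (∀ b → IsFormBound A b → b ≤ c)) →
               μ * dot x x ≤ quad A x
    conclude (c , bound , largest) = ≤-trans
      (≤-resp₂ (*-comm _ _) (*-comm _ _) (*-monoˡ-≤ (0≤dot x) μ≤c)) (bound x)
      where
      eigenvector = largest-bound-eigenvalue A-sym c bound largest
      μ≤c : μ ≤ c
      μ≤c = μ-least c (proj₁ eigenvector) (proj₂ eigenvector)

-- Distances in the corona

module Distance (G : Graph) (conn : Graph.Connected G) where
  open Graph G

  private
    d = dist G conn

  dist-walk : ∀ x y → Walk x y (d x y)
  dist-walk x y = proj₁ (proj₂ (least (walk? x y) (conn x y)))

  dist-least : ∀ {x y k} → Walk x y k → d x y ℕ.≤ k
  dist-least {x} {y} w = proj₂ (proj₂ (least (walk? x y) (conn x y))) _ w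

  dist-unique : ∀ x y {m} → Walk x y m → (∀ {k} → Walk x y k → m ℕ.≤ k) → d x y ≡ m
  dist-unique x y w shortest = ℕ.≤-antisym (dist-least w) (shortest (dist-walk x y))

  dist-self : ∀ x → d x x ≡ 0
  dist-self x = dist-unique x x nil (λ _ → z≤n)

  dist-step : ∀ {x y} z → Adj x y → d x z ℕ.≤ suc (d y z)
  dist-step z a = dist-least (step a (dist-walk _ z))

module CoronaDistance (G H : Graph) (conn : Graph.Connected G) where
  private
    module G = Graph G
    module H = Graph H
    module K = Graph (G ⊙ H)
  open Distance G conn
  open Distance (G ⊙ H) (⊙-connected G H conn)
    using () renaming (dist-unique to dist⊙-unique; dist-self to dist⊙-self)

  private
    d  = dist G conn
    d⊙ = dist (G ⊙ H) (⊙-connected G H conn)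

  root : K.V → G.V
  root (inj₁ x)       = x
  root (inj₂ (x , _)) = x

  height : K.V → ℕ
  height (inj₁ _) = 0
  height (inj₂ _) = 1

  base-walk : ∀ {x y k} → G.Walk x y k → K.Walk (inj₁ x) (inj₁ y) k
  base-walk G.nil        = K.nil
  base-walk (G.step a w) = K.step a (base-walk w)

  snoc : ∀ {p q r k} → K.Walk p q k → K.Adj q r → K.Walk p r (suc k)
  snoc K.nil b = K.step b K.nil
  snoc (K.step {y = s} a w) b = K.step {y = s} a (snoc w b)

  up-walk : ∀ {x y k} v → G.Walk x y k → K.Walk (inj₁ x) (inj₂ (y , v)) (suc k)
  up-walk v w = snoc (base-walk w) ≡.refl

  -- A copy communicates with the rest only through its root. Hence a walk that starts in a copy
  -- either ends in that copy or has spent a step on reaching the root, from where the first bound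
  -- takes over; the two bounds are therefore proved together.
  walk-lower : ∀ {x q k} → K.Walk (inj₁ x) q k → height q ℕ.+ d x (root q) ℕ.≤ k
  walk-lower-copy : ∀ {x u q k} → K.Walk (inj₂ (x , u)) q k →
    (∃ λ v → q ≡ inj₂ (x , v)) ⊎ (suc (height q ℕ.+ d x (root q)) ℕ.≤ k)

  walk-lower K.nil = dist-least G.nil
  walk-lower {x} {q} (K.step {y = inj₁ y} a w) = ℕ.≤-trans
    (ℕ.+-monoʳ-≤ (height q) (dist-step (root q) a))
    (ℕ.≤-trans (ℕ.≤-reflexive (ℕ.+-suc (height q) (d y (root q)))) (s≤s (walk-lower w)))
  walk-lower (K.step {y = inj₂ (x , u)} ≡.refl w) with walk-lower-copy w
  ... | inj₁ (v , ≡.refl) = s≤s (ℕ.≤-trans (dist-least G.nil) z≤n)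
  ... | inj₂ lower        = ℕ.m≤n⇒m≤1+n (ℕ.<⇒≤ lower)

  walk-lower-copy {u = u} K.nil = inj₁ (u , ≡.refl)
  walk-lower-copy (K.step {y = inj₁ x} ≡.refl w) = inj₂ (s≤s (walk-lower w))
  walk-lower-copy (K.step {y = inj₂ (x , v)} (≡.refl , a) w) with walk-lower-copy w
  ... | inj₁ same  = inj₁ same
  ... | inj₂ lower = inj₂ (ℕ.m≤n⇒m≤1+n lower)

  dist-base-base : ∀ x y → d⊙ (inj₁ x) (inj₁ y) ≡ d x y
  dist-base-base x y = dist⊙-unique (inj₁ x) (inj₁ y) (base-walk (dist-walk x y)) walk-lower

  dist-base-copy : ∀ x y v → d⊙ (inj₁ x) (inj₂ (y , v)) ≡ suc (d x y)
  dist-base-copy x y v = dist⊙-unique (inj₁ x) (inj₂ (y , v)) (up-walk v (dist-walk x y)) walk-lower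

  dist-copy-base : ∀ x u y → d⊙ (inj₂ (x , u)) (inj₁ y) ≡ suc (d x y)
  dist-copy-base x u y = dist⊙-unique (inj₂ (x , u)) (inj₁ y)
    (K.step {y = inj₁ x} ≡.refl (base-walk (dist-walk x y)))
    (λ w → [ (λ { (_ , ()) }) , (λ lower → lower) ]′ (walk-lower-copy w))

  dist-copy-copy : ∀ x u y v → x ≢ y → d⊙ (inj₂ (x , u)) (inj₂ (y , v)) ≡ suc (suc (d x y))
  dist-copy-copy x u y v x≢y = dist⊙-unique (inj₂ (x , u)) (inj₂ (y , v))
    (K.step {y = inj₁ x} ≡.refl (up-walk v (dist-walk x y)))
    (λ w → [ (λ { (_ , ≡.refl) → contradiction ≡.refl x≢y }) , (λ lower → lower) ]′ (walk-lower-copy w))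

  dist-copy-adjacent : ∀ x u v → H.Adj u v → d⊙ (inj₂ (x , u)) (inj₂ (x , v)) ≡ 1
  dist-copy-adjacent x u v a = dist⊙-unique (inj₂ (x , u)) (inj₂ (x , v)) (K.step {y = inj₂ (x , v)} (≡.refl , a) K.nil)
    shortest
    where
    shortest : ∀ {k} → K.Walk (inj₂ (x , u)) (inj₂ (x , v)) k → 1 ℕ.≤ k
    shortest K.nil        = contradiction a H.adj-irr
    shortest (K.step _ _) = s≤s z≤n

  dist-copy-far : ∀ x u v → u ≢ v → ¬ H.Adj u v → d⊙ (inj₂ (x , u)) (inj₂ (x , v)) ≡ 2
  dist-copy-far x u v u≢v ¬a = dist⊙-unique (inj₂ (x , u)) (inj₂ (x , v))
    (K.step {y = inj₁ x} ≡.refl (K.step {y = inj₂ (x , v)} ≡.refl K.nil)) shortest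
    where
    shortest : ∀ {k} → K.Walk (inj₂ (x , u)) (inj₂ (x , v)) k → 2 ℕ.≤ k
    shortest K.nil                            = contradiction ≡.refl u≢v
    shortest (K.step (_ , a) K.nil)           = contradiction a ¬a
    shortest (K.step _ (K.step _ _))          = s≤s (s≤s z≤n)

  dist-copy-self : ∀ x u → d⊙ (inj₂ (x , u)) (inj₂ (x , u)) ≡ 0
  dist-copy-self x u = dist⊙-self (inj₂ (x , u))

-- Sums and inner products over the vertices of a graph

module GraphSums (em : ExcludedMiddle ℓ) (ℝ : CompleteOrderedField ℓ) where
  open FiniteDimension em ℝ public
  open Real ℝ public
    using (C; ∑; ⟨_,_⟩; apply; 𝟏; adjacencyMatrix; distanceMatrix; ev; IsMaximum; IsMinimum; IsQEC)
  open SetoidReasoning setoid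

  -- An opaque copy of ∑, so that unification can read G and f off from Σ G f.
  opaque
    Σ : (G : Graph) → C G → Carrier
    Σ = ∑

    δ : (G : Graph) → Graph.V G → C G
    δ G x y = if does (Graph._≟ⱽ_ G x y) then 1# else 0#

  inner : (G : Graph) → C G → C G → Carrier
  inner G f g = Σ G (λ x → f x * g x)

  act : (G : Graph) → (Graph.V G → C G) → C G → C G
  act G M f x = Σ G (λ y → M x y * f y)

  -- Within one copy of H in the corona, A + 2 is twice the all-one matrix minus the distance
  -- matrix: its entries 2, 1, 0 belong to the distances 0, 1, 2.
  A+2 : (G : Graph) → C G → C G
  A+2 G f x = act G (adjacencyMatrix G) f x + fromℕ 2 * f x

  module _ {G : Graph} where
    open Graph G

    private variable
      f g : C G

    opaque
      unfolding Σ

      inner-∑ : ∀ f g → inner G f g ≡ ⟨_,_⟩ G f g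
      inner-∑ f g = ≡.refl

      inner-act-∑ : ∀ M f g → inner G f (act G M g) ≡ ⟨_,_⟩ G f (apply G M g)
      inner-act-∑ M f g = ≡.refl

      Σ-cong : (∀ x → f x ≈ g x) → Σ G f ≈ Σ G g
      Σ-cong f≈g = sum-cong-≋ (f≈g ∘ vertex)

      Σ-linear : ∀ c d f g → Σ G (λ x → c * f x + d * g x) ≈ c * Σ G f + d * Σ G g
      Σ-linear c d f g = sum-linear c d (f ∘ vertex) (g ∘ vertex)

      Σ-+ : ∀ f g → Σ G (λ x → f x + g x) ≈ Σ G f + Σ G g
      Σ-+ f g = ∑-distrib-+ (f ∘ vertex) (g ∘ vertex)

      Σ-*ˡ : ∀ c f → Σ G (λ x → c * f x) ≈ c * Σ G f
      Σ-*ˡ c f = sym (*-distribˡ-sum c (f ∘ vertex))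

      Σ-mono-≤ : (∀ x → f x ≤ g x) → Σ G f ≤ Σ G g
      Σ-mono-≤ f≤g = sum-mono-≤ (f≤g ∘ vertex)

      Σ-nonNegative : (∀ x → 0# ≤ f x) → 0# ≤ Σ G f
      Σ-nonNegative 0≤f = sum-nonNegative (0≤f ∘ vertex)

      Σ-single : ∀ x → (∀ y → y ≢ x → f y ≈ 0#) → Σ G f ≈ f x
      Σ-single {f} x f≈0 = trans
        (sum-single i (λ j j≢i → f≈0 (vertex j) (j≢i ∘ index-unique j)))
        (reflexive (≡.cong f (Inverse.strictlyInverseʳ enum x)))
        where
        i : Fin order
        i = Inverse.to enum x
        index-unique : ∀ j → vertex j ≡ x → j ≡ i
        index-unique j v≡x = ≡.trans (≡.sym (Inverse.strictlyInverseˡ enum j)) (≡.cong (Inverse.to enum) v≡x)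

      Σ-constant : ∀ c → Σ G (λ _ → c) ≈ fromℕ order * c
      Σ-constant c = sum-constant order c

      row-sum : ∀ x → Σ G (adjacencyMatrix G x) ≈ fromℕ (degree x)
      row-sum x = go vertex
        where
        go : ∀ {n} (v : Fin n → V) →
             sum (λ i → adjacencyMatrix G x (v i)) ≈ fromℕ (count (adj? x) (tabulate v))
        go {zero}  v = refl
        go {suc n} v with adj? x (v zero)
        ... | yes _ = +-congˡ (go (v ∘ suc))
        ... | no  _ = trans (+-identityˡ _) (go (v ∘ suc))

    Σ-zero : (∀ x → f x ≈ 0#) → Σ G f ≈ 0#
    Σ-zero f≈0 = trans (Σ-cong f≈0) (trans (Σ-constant 0#) (zeroʳ _))

    opaque
      unfolding δ

      δ-on : ∀ x → δ G x x ≈ 1#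
      δ-on x rewrite dec-true (x ≟ⱽ x) ≡.refl = refl

      δ-off : ∀ {x y} → x ≢ y → δ G x y ≈ 0#
      δ-off {x} {y} x≢y rewrite dec-false (x ≟ⱽ y) x≢y = refl

    Σ-δ : ∀ x (f : C G) → Σ G (λ y → δ G x y * f y) ≈ f x
    Σ-δ x f = begin
      Σ G (λ y → δ G x y * f y) ≈⟨ Σ-single x (λ y y≢x → trans (*-congʳ (δ-off (y≢x ∘ ≡.sym))) (zeroˡ (f y))) ⟩
      δ G x x * f x             ≈⟨ *-congʳ (δ-on x) ⟩
      1# * f x                ≈⟨ *-identityˡ (f x) ⟩
      f x                     ∎

    adjacency-sym : ∀ x y → adjacencyMatrix G x y ≈ adjacencyMatrix G y x
    adjacency-sym x y with adj? x y | adj? y x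
    ... | yes _ | yes _ = refl
    ... | no  _ | no  _ = refl
    ... | yes a | no ¬a = contradiction (adj-sym a) ¬a
    ... | no ¬a | yes a = contradiction (adj-sym a) ¬a

    adjacency-on : ∀ {x y} → Adj x y → adjacencyMatrix G x y ≈ 1#
    adjacency-on {x} {y} a rewrite dec-true (adj? x y) a = refl

    adjacency-off : ∀ {x y} → ¬ Adj x y → adjacencyMatrix G x y ≈ 0#
    adjacency-off {x} {y} ¬a rewrite dec-false (adj? x y) ¬a = refl

  -- `splitAt`, and `remQuot` below, underlie `+↔⊎` and `*↔×`, from which the enumeration of the
  -- corona is assembled.
  sum-splitAt : ∀ m {n} (φ : Fin m ⊎ Fin n → Carrier) →
                sum (φ ∘ splitAt m) ≈ sum (φ ∘ inj₁) + sum (φ ∘ inj₂)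
  sum-splitAt zero    φ = sym (+-identityˡ _)
  sum-splitAt (suc m) φ = trans (+-congˡ (sum-splitAt m (φ ∘ Sum.map₁ suc))) (sym (+-assoc _ _ _))

  sum-remQuot : ∀ m n (φ : Fin m × Fin n → Carrier) →
                sum (φ ∘ remQuot {m} n) ≈ sum (λ i → sum (λ j → φ (i , j)))
  sum-remQuot zero    n φ = refl
  sum-remQuot (suc m) n φ = trans
    -- This function is `remQuot` at `suc m` unfolded: `quotRem` with its components swapped, where
    -- `quotRem` branches on `splitAt n`.
    (sum-splitAt n (φ ∘ Product.swap ∘ [ (_, zero) , Product.map₂ suc ∘ quotRem {m} n ]′))
    (+-congˡ (sum-remQuot m n (φ ∘ Product.map₁ suc)))

  opaque
    unfolding Σ

    Σ-⊙ : ∀ G H (f : C (G ⊙ H)) →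
          Σ (G ⊙ H) f ≈ Σ G (λ x → f (inj₁ x) + Σ H (λ u → f (inj₂ (x , u))))
    Σ-⊙ G H f = begin
      Σ (G ⊙ H) f
        ≈⟨ sum-splitAt G.order (f ∘ Sum.map G.vertex (Product.map G.vertex H.vertex ∘ remQuot H.order)) ⟩
      sum (λ i → f (inj₁ (G.vertex i))) + sum (λ k → f (inj₂ (Product.map G.vertex H.vertex (remQuot {G.order} H.order k))))
        ≈⟨ +-congˡ (sum-remQuot G.order H.order (λ p → f (inj₂ (Product.map G.vertex H.vertex p)))) ⟩
      Σ G (λ x → f (inj₁ x)) + Σ G (λ x → Σ H (λ u → f (inj₂ (x , u))))
        ≈⟨ Σ-+ {G} (λ x → f (inj₁ x)) (λ x → Σ H (λ u → f (inj₂ (x , u)))) ⟨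
      Σ G (λ x → f (inj₁ x) + Σ H (λ u → f (inj₂ (x , u)))) ∎
      where
      module G = Graph G
      module H = Graph H

-- The inverse of ψ: on x > - k / N, ψ(x) = q is the quadratic equation x² - b x - k q = 0.
module PsiInverse (em : ExcludedMiddle ℓ) (ℝ : CompleteOrderedField ℓ) where
  open RealField em ℝ

  module Coefficients (n N k q : Carrier) (N≈n+1 : N ≈ n + 1#) (0<n : 0# < n) (0<k : 0# < k) where
    open SetoidReasoning setoid

    b disc : Carrier
    b    = N * q - k
    disc = b * b + fromℕ 4 * k * q

    0<N : 0# < N
    0<N = <-respʳ (trans (+-comm 1# n) (sym N≈n+1)) (+-positive 0<1 (proj₁ 0<n))

    0<2 : 0# < fromℕ 2
    0<2 = fromℕ-positive {2} (s≤s z≤n)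

    0<4 : 0# < fromℕ 4
    0<4 = fromℕ-positive {4} (s≤s z≤n)

    -- The left side is -4N² times the value of x² - b x - k q at the pole - k / N of ψ. Its
    -- positivity puts the pole strictly between the two roots, whatever the sign of q, so the
    -- discriminant is positive and just one root lies in the domain.
    vertex-gap : (N * N) * disc - (k + k + N * b) * (k + k + N * b) ≈ fromℕ 4 * (k * k) * n
    vertex-gap = begin
      (N * N) * disc - (k + k + N * b) * (k + k + N * b)
        ≈⟨ solve 3 (λ N k q → let b = N :* q :- k in
             (N :* N) :* (b :* b :+ con (+ 4) :* k :* q) :- (k :+ k :+ N :* b) :* (k :+ k :+ N :* b)
             := con (+ 4) :* (k :* k) :* (N :- con (+ 1))) refl N k q ⟩
      fromℕ 4 * (k * k) * (N - 1#)
        ≈⟨ *-congˡ (trans (+-congʳ N≈n+1) (solve 1 (λ n → n :+ con (+ 1) :- con (+ 1) := n) refl n)) ⟩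
      fromℕ 4 * (k * k) * n ∎

    vertex-< : (k + k + N * b) * (k + k + N * b) < (N * N) * disc
    vertex-< = 0<y-x⇒x<y (<-respʳ (sym vertex-gap) (*-positive (*-positive 0<4 (*-positive 0<k 0<k)) 0<n))

    0<disc : 0# < disc
    0<disc = *-cancelˡ-positive (*-positive 0<N 0<N) (≤-<-trans (0≤x*x (k + k + N * b)) vertex-<)

    module Root (s r : Carrier) (0≤s : 0# ≤ s) (ss≈disc : s * s ≈ disc) (2r≈b+s : fromℕ 2 * r ≈ b + s) where

      NsNs : N * N * disc ≈ N * s * (N * s)
      NsNs = trans (*-congˡ (sym ss≈disc)) (solve 2 (λ N s → N :* N :* (s :* s) := N :* s :* (N :* s)) refl N s)

      0≤Ns : 0# ≤ N * s
      0≤Ns = *-nonNegative (proj₁ 0<N) 0≤s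

      -- The two signs of this estimate locate the roots: this one puts the smaller root below the
      -- pole, the next one puts r above it.
      2k+Nb<Ns : k + k + N * b < N * s
      2k+Nb<Ns = square-cancel-< 0≤Ns (<-respʳ NsNs vertex-<)

      -2k-Nb<Ns : - (k + k + N * b) < N * s
      -2k-Nb<Ns = square-cancel-< 0≤Ns
        (≤-<-trans (≤-reflexive (solve 1 (λ a → (:- a) :* (:- a) := a :* a) refl (k + k + N * b)))
          (<-respʳ NsNs vertex-<))

      IsRoot : Carrier → Set _
      IsRoot x = x * (x + k) ≈ q * (N * x + k)

      r-root : IsRoot r
      r-root = *-cancelˡ-≈ 0<4 (begin
        fromℕ 4 * (r * (r + k))
          ≈⟨ solve 2 (λ r k → con (+ 4) :* (r :* (r :+ k)) := (con (+ 2) :* r) :* (con (+ 2) :* r) :+ con (+ 2) :* k :* (con (+ 2) :* r)) refl r k ⟩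
        (fromℕ 2 * r) * (fromℕ 2 * r) + fromℕ 2 * k * (fromℕ 2 * r)
          ≈⟨ +-cong (*-cong 2r≈b+s 2r≈b+s) (*-congˡ 2r≈b+s) ⟩
        (b + s) * (b + s) + fromℕ 2 * k * (b + s)
          ≈⟨ solve 4 (λ N k q s → let b = N :* q :- k in
               (b :+ s) :* (b :+ s) :+ con (+ 2) :* k :* (b :+ s)
               := s :* s :+ (b :* b :+ (b :+ k) :* con (+ 2) :* s :+ con (+ 2) :* k :* b)) refl N k q s ⟩
        s * s + _
          ≈⟨ +-congʳ ss≈disc ⟩
        disc + (b * b + (b + k) * fromℕ 2 * s + fromℕ 2 * k * b)
          ≈⟨ solve 4 (λ N k q s → let b = N :* q :- k in
               (b :* b :+ con (+ 4) :* k :* q) :+ (b :* b :+ (b :+ k) :* con (+ 2) :* s :+ con (+ 2) :* k :* b)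
               := con (+ 2) :* q :* (N :* (b :+ s) :+ con (+ 2) :* k)) refl N k q s ⟩
        fromℕ 2 * q * (N * (b + s) + fromℕ 2 * k)
          ≈⟨ *-congˡ (+-congʳ (*-congˡ 2r≈b+s)) ⟨
        fromℕ 2 * q * (N * (fromℕ 2 * r) + fromℕ 2 * k)
          ≈⟨ solve 4 (λ N k q r → con (+ 2) :* q :* (N :* (con (+ 2) :* r) :+ con (+ 2) :* k)
               := con (+ 4) :* (q :* (N :* r :+ k))) refl N k q r ⟩
        fromℕ 4 * (q * (N * r + k)) ∎)

      0<Nr+k : 0# < N * r + k
      0<Nr+k = *-cancelˡ-positive 0<2 (<-respʳ
        (begin
          N * s - - (k + k + N * b)        ≈⟨ solve 4 (λ N k b s → N :* s :- (:- (k :+ k :+ N :* b)) := N :* (b :+ s) :+ con (+ 2) :* k) refl N k b s ⟩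
          N * (b + s) + fromℕ 2 * k        ≈⟨ +-congʳ (*-congˡ 2r≈b+s) ⟨
          N * (fromℕ 2 * r) + fromℕ 2 * k  ≈⟨ solve 3 (λ N k r → N :* (con (+ 2) :* r) :+ con (+ 2) :* k := con (+ 2) :* (N :* r :+ k)) refl N k r ⟩
          fromℕ 2 * (N * r + k)            ∎)
        (x<y⇒0<y-x -2k-Nb<Ns))

      N*[x+k/N] : ∀ x → N * (x - - (k / N)) ≈ N * x + k
      N*[x+k/N] x = begin
        N * (x - - (k / N))    ≈⟨ solve 3 (λ N x y → N :* (x :- (:- y)) := N :* x :+ N :* y) refl N x (k / N) ⟩
        N * x + N * (k / N)    ≈⟨ +-congˡ (/-cancel 0<N) ⟩
        N * x + k              ∎

      domain⇒positive : ∀ {x} → - (k / N) < x → 0# < N * x + k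
      domain⇒positive {x} x-in = <-respʳ (N*[x+k/N] x) (*-positive 0<N (x<y⇒0<y-x x-in))

      positive⇒domain : ∀ {x} → 0# < N * x + k → - (k / N) < x
      positive⇒domain {x} 0<Nx+k = 0<y-x⇒x<y (*-cancelˡ-positive 0<N (<-respʳ (sym (N*[x+k/N] x)) 0<Nx+k))

      r-domain : - (k / N) < r
      r-domain = positive⇒domain 0<Nr+k

      r-value : (r * (r + k)) / (N * r + k) ≈ q
      r-value = *-cancelˡ-≈ 0<Nr+k (trans (/-cancel 0<Nr+k) (trans r-root (*-comm _ _)))

      -- The other root b - r = (b - s) / 2 lies outside the domain.
      r-unique : ∀ x → - (k / N) < x → (x * (x + k)) / (N * x + k) ≈ q → x ≈ r
      r-unique x x-in ψx≈q with em {x - r ≈ 0#}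
      ... | yes x-r≈0 = begin
        x            ≈⟨ solve 2 (λ x r → x := (x :- r) :+ r) refl x r ⟩
        (x - r) + r  ≈⟨ +-congʳ x-r≈0 ⟩
        0# + r       ≈⟨ +-identityˡ r ⟩
        r            ∎
      ... | no x-r≉0 = contradiction (proj₁ 2k+Nb<Ns) (x<y⇒y≰x Ns<2k+Nb)
        where
        x-root : IsRoot x
        x-root = trans (sym (/-cancel (domain⇒positive x-in))) (trans (*-congˡ ψx≈q) (*-comm _ _))
        product : (x - r) * (x + r - b) ≈ 0#
        product = begin
          (x - r) * (x + r - b)
            ≈⟨ solve 5 (λ x r N k q → (x :- r) :* (x :+ r :- (N :* q :- k))
                 := (x :* (x :+ k) :- q :* (N :* x :+ k)) :- (r :* (r :+ k) :- q :* (N :* r :+ k))) refl x r N k q ⟩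
          (x * (x + k) - q * (N * x + k)) - (r * (r + k) - q * (N * r + k))
            ≈⟨ +-cong (+-congʳ x-root) (-‿cong (+-congʳ r-root)) ⟩
          (q * (N * x + k) - q * (N * x + k)) - (q * (N * r + k) - q * (N * r + k))
            ≈⟨ solve 2 (λ a b → (a :- a) :- (b :- b) := con (+ 0)) refl (q * (N * x + k)) (q * (N * r + k)) ⟩
          0# ∎
        sum-of-roots : x + r - b ≈ 0#
        sum-of-roots = x*y≈0⇒y≈0 x-r≉0 product
        Ns<2k+Nb : N * s < k + k + N * b
        Ns<2k+Nb = 0<y-x⇒x<y (<-respʳ
          (begin
            fromℕ 2 * (N * x + k)
              ≈⟨ solve 5 (λ N x k r b → con (+ 2) :* (N :* x :+ k)
                   := con (+ 2) :* N :* (x :+ r :- b) :+ (con (+ 2) :* N :* b :+ con (+ 2) :* k :- N :* (con (+ 2) :* r))) refl N x k r b ⟩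
            fromℕ 2 * N * (x + r - b) + (fromℕ 2 * N * b + fromℕ 2 * k - N * (fromℕ 2 * r))
              ≈⟨ +-cong (*-congˡ sum-of-roots) (+-congˡ (-‿cong (*-congˡ 2r≈b+s))) ⟩
            fromℕ 2 * N * 0# + (fromℕ 2 * N * b + fromℕ 2 * k - N * (b + s))
              ≈⟨ solve 4 (λ N k b s → con (+ 2) :* N :* con (+ 0) :+ (con (+ 2) :* N :* b :+ con (+ 2) :* k :- N :* (b :+ s))
                   := k :+ k :+ N :* b :- N :* s) refl N k b s ⟩
            k + k + N * b - N * s ∎)
          (*-positive 0<2 (domain⇒positive x-in)))

      module Positive (0<q : 0# < q) where

        -- The product of the roots is - k q < 0; equivalently s² > b², so b + s is positive.
        0<r : 0# < r
        0<r = *-cancelˡ-positive 0<2 (<-respʳ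
          (trans (solve 2 (λ b s → s :- (:- b) := b :+ s) refl b s) (sym 2r≈b+s))
          (x<y⇒0<y-x (square-cancel-< 0≤s (0<y-x⇒x<y (<-respʳ gap (*-positive (*-positive 0<4 0<k) 0<q))))))
          where
          gap : fromℕ 4 * k * q ≈ s * s - (- b) * (- b)
          gap = begin
            fromℕ 4 * k * q        ≈⟨ solve 2 (λ b c → c := b :* b :+ c :- (:- b) :* (:- b)) refl b (fromℕ 4 * k * q) ⟩
            disc - (- b) * (- b)   ≈⟨ +-congʳ ss≈disc ⟨
            s * s - (- b) * (- b)  ∎

        -- Subtract q (r + k) from both sides of the root equation and use N - 1 = n. As the right
        -- side is positive, r > q follows, hence a positive leading coefficient n (r - q) in the
        -- binary form below.
        root-gap : (r + k) * (r - q) ≈ n * q * r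
        root-gap = begin
          (r + k) * (r - q)
            ≈⟨ solve 3 (λ r k q → (r :+ k) :* (r :- q) := r :* (r :+ k) :- q :* (r :+ k)) refl r k q ⟩
          r * (r + k) - q * (r + k)
            ≈⟨ +-congʳ r-root ⟩
          q * (N * r + k) - q * (r + k)
            ≈⟨ +-congʳ (*-congˡ (+-congʳ (*-congʳ N≈n+1))) ⟩
          q * ((n + 1#) * r + k) - q * (r + k)
            ≈⟨ solve 4 (λ n r k q → q :* ((n :+ con (+ 1)) :* r :+ k) :- q :* (r :+ k) := n :* q :* r) refl n r k q ⟩
          n * q * r ∎

        0<r-q : 0# < r - q
        0<r-q = *-cancelˡ-positive (+-positive 0<r (proj₁ 0<k))
          (<-respʳ (sym root-gap) (*-positive (*-positive 0<n 0<q) 0<r))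

        -- The binary form on the left has determinant a multiple of
        -- (r + k)(r - q) - n q r = 0.
        form-nonNegative : ∀ g t →
          0# ≤ n * (r - q) * (g * g) - (n * q * (g * t) + n * q * (g * t)) + (r + k - n * q) * (t * t)
        form-nonNegative g t = *-cancelˡ-nonNegative 0<r-q (≤-respʳ (sym square)
          (*-nonNegative (proj₁ 0<n) (0≤x*x ((r - q) * g - q * t))))
          where
          square : (r - q) * (n * (r - q) * (g * g) - (n * q * (g * t) + n * q * (g * t)) + (r + k - n * q) * (t * t))
                   ≈ n * (((r - q) * g - q * t) * ((r - q) * g - q * t))
          square = begin
            (r - q) * (n * (r - q) * (g * g) - (n * q * (g * t) + n * q * (g * t)) + (r + k - n * q) * (t * t))
              ≈⟨ solve 6 (λ n d q g t e →
                   d :* (n :* d :* (g :* g) :- (n :* q :* (g :* t) :+ n :* q :* (g :* t)) :+ (e :- n :* q) :* (t :* t))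
                   := (e :* d :- n :* q :* (d :+ q)) :* (t :* t) :+ n :* ((d :* g :- q :* t) :* (d :* g :- q :* t)))
                   refl n (r - q) q g t (r + k) ⟩
            ((r + k) * (r - q) - n * q * (r - q + q)) * (t * t) + n * (((r - q) * g - q * t) * ((r - q) * g - q * t))
              ≈⟨ +-congʳ (*-congʳ (+-cong root-gap (-‿cong (*-congˡ (solve 2 (λ r q → r :- q :+ q := r) refl r q))))) ⟩
            (n * q * r - n * q * r) * (t * t) + n * (((r - q) * g - q * t) * ((r - q) * g - q * t))
              ≈⟨ solve 3 (λ a t z → (a :- a) :* t :+ z := z) refl (n * q * r) (t * t) (n * (((r - q) * g - q * t) * ((r - q) * g - q * t))) ⟩
            n * (((r - q) * g - q * t) * ((r - q) * g - q * t)) ∎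

-- The distance form of the corona

module CoronaForm (em : ExcludedMiddle ℓ) (ℝ : CompleteOrderedField ℓ)
  (G H : Graph) (conn : Graph.Connected G) where
  open GraphSums em ℝ
  open SetoidReasoning setoid
  private
    module G = Graph G
    module H = Graph H
    K = G ⊙ H
    conn⊙ = ⊙-connected G H conn
  open Distance G conn
  open CoronaDistance G H conn

  D : G.V → C G
  D = distanceMatrix G conn

  D⊙ : Graph.V K → C K
  D⊙ = distanceMatrix K conn⊙

  A : H.V → C H
  A = adjacencyMatrix H

  A+2-sum : ∀ h u → Σ H (λ v → (A u v + fromℕ 2 * δ H u v) * h v) ≈ A+2 H h u
  A+2-sum h u = begin
    Σ H (λ v → (A u v + fromℕ 2 * δ H u v) * h v)
      ≈⟨ Σ-cong (λ v → solve 4 (λ a t d h → (a :+ t :* d) :* h := con (+ 1) :* (a :* h) :+ t :* (d :* h)) refl (A u v) (fromℕ 2) (δ H u v) (h v)) ⟩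
    Σ H (λ v → 1# * (A u v * h v) + fromℕ 2 * (δ H u v * h v))
      ≈⟨ Σ-linear 1# (fromℕ 2) (λ v → A u v * h v) (λ v → δ H u v * h v) ⟩
    1# * act H A h u + fromℕ 2 * Σ H (λ v → δ H u v * h v)
      ≈⟨ +-cong (*-identityˡ _) (*-congˡ (Σ-δ u h)) ⟩
    A+2 H h u ∎

  -- Vertices in different copies are two steps further apart than their roots. In one copy D x x =
  -- 0, and the distance is 2 minus the entry of A + 2. The factor `δ G x y` merges both cases into
  -- one summable formula.
  entry-copy-copy : ∀ x u y v →
    D⊙ (inj₂ (x , u)) (inj₂ (y , v)) ≈
    (fromℕ 2 + D x y) + - δ G x y * (A u v + fromℕ 2 * δ H u v)
  entry-copy-copy x u y v = cases (x G.≟ⱽ y) (u H.≟ⱽ v) (H.adj? u v)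
    where
    entry : ∀ {m d e a e′} → dist K conn⊙ (inj₂ (x , u)) (inj₂ (y , v)) ≡ m →
            D x y ≈ d → δ G x y ≈ e → A u v ≈ a → δ H u v ≈ e′ →
            fromℕ m ≈ (fromℕ 2 + d) + - e * (a + fromℕ 2 * e′) →
            D⊙ (inj₂ (x , u)) (inj₂ (y , v)) ≈
            (fromℕ 2 + D x y) + - δ G x y * (A u v + fromℕ 2 * δ H u v)
    entry m≡ d≈ e≈ a≈ e′≈ value = trans (reflexive (≡.cong fromℕ m≡)) (trans value
      (sym (+-cong (+-congˡ d≈) (*-cong (-‿cong e≈) (+-cong a≈ (*-congˡ e′≈))))))

    cases : Dec (x ≡ y) → Dec (u ≡ v) → Dec (H.Adj u v) →
            D⊙ (inj₂ (x , u)) (inj₂ (y , v)) ≈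
            (fromℕ 2 + D x y) + - δ G x y * (A u v + fromℕ 2 * δ H u v)
    cases (no x≢y) _ _ = entry (dist-copy-copy x u y v x≢y) refl (δ-off x≢y) refl refl
      (solve 2 (λ d b → con (+ 1) :+ (con (+ 1) :+ d) := (con (+ 2) :+ d) :+ (:- con (+ 0)) :* b)
        refl (D x y) (A u v + fromℕ 2 * δ H u v))
    cases (yes ≡.refl) (yes ≡.refl) _ = entry (dist-copy-self x u) (reflexive (≡.cong fromℕ (dist-self x)))
      (δ-on x) (adjacency-off {H} H.adj-irr) (δ-on u)
      (solve 0 (con (+ 0) := (con (+ 2) :+ con (+ 0)) :+ (:- con (+ 1)) :* (con (+ 0) :+ con (+ 2) :* con (+ 1))) refl)
    cases (yes ≡.refl) (no u≢v) (yes a) = entry (dist-copy-adjacent x u v a) (reflexive (≡.cong fromℕ (dist-self x)))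
      (δ-on x) (adjacency-on {H} a) (δ-off u≢v)
      (solve 0 (con (+ 1) :+ con (+ 0) := (con (+ 2) :+ con (+ 0)) :+ (:- con (+ 1)) :* (con (+ 1) :+ con (+ 2) :* con (+ 0))) refl)
    cases (yes ≡.refl) (no u≢v) (no ¬a) = entry (dist-copy-far x u v u≢v ¬a) (reflexive (≡.cong fromℕ (dist-self x)))
      (δ-on x) (adjacency-off {H} ¬a) (δ-off u≢v)
      (solve 0 (con (+ 2) := (con (+ 2) :+ con (+ 0)) :+ (:- con (+ 1)) :* (con (+ 0) :+ con (+ 2) :* con (+ 0))) refl)

  base : C K → C G
  base F x = F (inj₁ x)

  copy : C K → G.V → C H
  copy F x u = F (inj₂ (x , u))

  copyTotal : C K → C G
  copyTotal F x = Σ H (copy F x)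

  vertexTotal : C K → C G
  vertexTotal F x = base F x + copyTotal F x

  Σ-vertexTotal : ∀ F → Σ K F ≈ Σ G (vertexTotal F)
  Σ-vertexTotal F = Σ-⊙ G H F

  act-base : ∀ F x → act K D⊙ F (inj₁ x) ≈ act G D (vertexTotal F) x + Σ G (copyTotal F)
  act-base F x = begin
    act K D⊙ F (inj₁ x)
      ≈⟨ Σ-⊙ G H (λ q → D⊙ (inj₁ x) q * F q) ⟩
    Σ G (λ y → D⊙ (inj₁ x) (inj₁ y) * base F y + Σ H (λ v → D⊙ (inj₁ x) (inj₂ (y , v)) * copy F y v))
      ≈⟨ Σ-cong term ⟩
    Σ G (λ y → D x y * vertexTotal F y + copyTotal F y)
      ≈⟨ Σ-+ (λ y → D x y * vertexTotal F y) (copyTotal F) ⟩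
    act G D (vertexTotal F) x + Σ G (copyTotal F) ∎
    where
    term : ∀ y → D⊙ (inj₁ x) (inj₁ y) * base F y + Σ H (λ v → D⊙ (inj₁ x) (inj₂ (y , v)) * copy F y v)
                 ≈ D x y * vertexTotal F y + copyTotal F y
    term y = begin
      D⊙ (inj₁ x) (inj₁ y) * base F y + Σ H (λ v → D⊙ (inj₁ x) (inj₂ (y , v)) * copy F y v)
        ≈⟨ +-cong (*-congʳ (reflexive (≡.cong fromℕ (dist-base-base x y))))
             (Σ-cong (λ v → *-congʳ (reflexive (≡.cong fromℕ (dist-base-copy x y v))))) ⟩
      D x y * base F y + Σ H (λ v → (1# + D x y) * copy F y v)
        ≈⟨ +-congˡ (Σ-*ˡ (1# + D x y) (copy F y)) ⟩
      D x y * base F y + (1# + D x y) * copyTotal F y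
        ≈⟨ solve 3 (λ d g t → d :* g :+ (con (+ 1) :+ d) :* t := d :* (g :+ t) :+ t) refl (D x y) (base F y) (copyTotal F y) ⟩
      D x y * vertexTotal F y + copyTotal F y ∎

  -- Compared with `act-base`, starting inside a copy lengthens every distance by one, which adds
  -- the total of F. The copy of x itself is corrected by A + 2, since walks there need not pass
  -- through x.
  act-copy : ∀ F x u → act K D⊙ F (inj₂ (x , u)) ≈
             act G D (vertexTotal F) x + (Σ G (vertexTotal F) + Σ G (copyTotal F)) + - A+2 H (copy F x) u
  act-copy F x u = begin
    act K D⊙ F (inj₂ (x , u))
      ≈⟨ Σ-⊙ G H (λ q → D⊙ (inj₂ (x , u)) q * F q) ⟩
    Σ G (λ y → D⊙ (inj₂ (x , u)) (inj₁ y) * base F y + Σ H (λ v → D⊙ (inj₂ (x , u)) (inj₂ (y , v)) * copy F y v))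
      ≈⟨ Σ-cong term ⟩
    Σ G (λ y → (D x y * vertexTotal F y + (vertexTotal F y + copyTotal F y)) + δ G x y * - A+2 H (copy F y) u)
      ≈⟨ Σ-+ (λ y → D x y * vertexTotal F y + (vertexTotal F y + copyTotal F y)) (λ y → δ G x y * - A+2 H (copy F y) u) ⟩
    Σ G (λ y → D x y * vertexTotal F y + (vertexTotal F y + copyTotal F y)) + Σ G (λ y → δ G x y * - A+2 H (copy F y) u)
      ≈⟨ +-cong
           (trans (Σ-+ (λ y → D x y * vertexTotal F y) (λ y → vertexTotal F y + copyTotal F y))
                  (+-congˡ (Σ-+ (vertexTotal F) (copyTotal F))))
           (Σ-δ x (λ y → - A+2 H (copy F y) u)) ⟩
    act G D (vertexTotal F) x + (Σ G (vertexTotal F) + Σ G (copyTotal F)) + - A+2 H (copy F x) u ∎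
    where
    term : ∀ y → D⊙ (inj₂ (x , u)) (inj₁ y) * base F y + Σ H (λ v → D⊙ (inj₂ (x , u)) (inj₂ (y , v)) * copy F y v)
                 ≈ (D x y * vertexTotal F y + (vertexTotal F y + copyTotal F y)) + δ G x y * - A+2 H (copy F y) u
    term y = begin
      D⊙ (inj₂ (x , u)) (inj₁ y) * base F y + Σ H (λ v → D⊙ (inj₂ (x , u)) (inj₂ (y , v)) * copy F y v)
        ≈⟨ +-cong (*-congʳ (reflexive (≡.cong fromℕ (dist-copy-base x u y)))) (Σ-cong (λ v → *-congʳ (entry-copy-copy x u y v))) ⟩
      (1# + D x y) * base F y + Σ H (λ v → ((fromℕ 2 + D x y) + - δ G x y * (A u v + fromℕ 2 * δ H u v)) * copy F y v)
        ≈⟨ +-congˡ (Σ-cong (λ v → solve 4 (λ c e b h → (c :+ e :* b) :* h := c :* h :+ e :* (b :* h))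
             refl (fromℕ 2 + D x y) (- δ G x y) (A u v + fromℕ 2 * δ H u v) (copy F y v))) ⟩
      (1# + D x y) * base F y + Σ H (λ v → (fromℕ 2 + D x y) * copy F y v + - δ G x y * ((A u v + fromℕ 2 * δ H u v) * copy F y v))
        ≈⟨ +-congˡ (Σ-linear (fromℕ 2 + D x y) (- δ G x y) (copy F y) (λ v → (A u v + fromℕ 2 * δ H u v) * copy F y v)) ⟩
      (1# + D x y) * base F y + ((fromℕ 2 + D x y) * copyTotal F y + - δ G x y * Σ H (λ v → (A u v + fromℕ 2 * δ H u v) * copy F y v))
        ≈⟨ +-congˡ (+-congˡ (*-congˡ (A+2-sum (copy F y) u))) ⟩
      (1# + D x y) * base F y + ((fromℕ 2 + D x y) * copyTotal F y + - δ G x y * A+2 H (copy F y) u)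
        ≈⟨ solve 5 (λ d g t e b → (con (+ 1) :+ d) :* g :+ ((con (+ 2) :+ d) :* t :+ (:- e) :* b)
             := (d :* (g :+ t) :+ ((g :+ t) :+ t)) :+ e :* (:- b)) refl (D x y) (base F y) (copyTotal F y) (δ G x y) (A+2 H (copy F y) u) ⟩
      (D x y * vertexTotal F y + (vertexTotal F y + copyTotal F y)) + δ G x y * - A+2 H (copy F y) u ∎

  copyForm : C K → C G
  copyForm F x = inner H (copy F x) (A+2 H (copy F x))

  -- Apart from the correction inside each copy, a distance is that of the roots plus one for each
  -- endpoint lying in a copy. These extra steps contribute only multiples of Σ S, which vanish.
  corona-form : ∀ F → Σ G (vertexTotal F) ≈ 0# →
    inner K F (act K D⊙ F) ≈ inner G (vertexTotal F) (act G D (vertexTotal F)) - Σ G (copyForm F)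
  corona-form F ΣS≈0 = begin
    inner K F (act K D⊙ F)
      ≈⟨ Σ-⊙ G H (λ q → F q * act K D⊙ F q) ⟩
    Σ G (λ x → base F x * act K D⊙ F (inj₁ x) + Σ H (λ u → copy F x u * act K D⊙ F (inj₂ (x , u))))
      ≈⟨ Σ-cong term ⟩
    Σ G (λ x → S x * act G D S x + (τ * S x + - 1# * copyForm F x))
      ≈⟨ Σ-+ (λ x → S x * act G D S x) (λ x → τ * S x + - 1# * copyForm F x) ⟩
    inner G S (act G D S) + Σ G (λ x → τ * S x + - 1# * copyForm F x)
      ≈⟨ +-congˡ (Σ-linear τ (- 1#) S (copyForm F)) ⟩
    inner G S (act G D S) + (τ * Σ G S + - 1# * Σ G (copyForm F))
      ≈⟨ +-congˡ (+-congʳ (*-congˡ ΣS≈0)) ⟩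
    inner G S (act G D S) + (τ * 0# + - 1# * Σ G (copyForm F))
      ≈⟨ solve 3 (λ p t i → p :+ (t :* con (+ 0) :+ (:- con (+ 1)) :* i) := p :- i) refl (inner G S (act G D S)) τ (Σ G (copyForm F)) ⟩
    inner G S (act G D S) - Σ G (copyForm F) ∎
    where
    S = vertexTotal F
    τ = Σ G (copyTotal F)
    term : ∀ x → base F x * act K D⊙ F (inj₁ x) + Σ H (λ u → copy F x u * act K D⊙ F (inj₂ (x , u)))
                 ≈ S x * act G D S x + (τ * S x + - 1# * copyForm F x)
    term x = begin
      base F x * act K D⊙ F (inj₁ x) + Σ H (λ u → copy F x u * act K D⊙ F (inj₂ (x , u)))
        ≈⟨ +-cong (*-congˡ (act-base F x)) (Σ-cong (λ u → *-congˡ (trans (act-copy F x u)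
             (+-congʳ (+-congˡ (trans (+-congʳ ΣS≈0) (+-identityˡ τ))))))) ⟩
      base F x * w + Σ H (λ u → copy F x u * (w + - A+2 H (copy F x) u))
        ≈⟨ +-congˡ (Σ-cong (λ u → solve 3 (λ h w b → h :* (w :+ (:- b)) := w :* h :+ (:- con (+ 1)) :* (h :* b)) refl (copy F x u) w (A+2 H (copy F x) u))) ⟩
      base F x * w + Σ H (λ u → w * copy F x u + - 1# * (copy F x u * A+2 H (copy F x) u))
        ≈⟨ +-congˡ (Σ-linear w (- 1#) (copy F x) (λ u → copy F x u * A+2 H (copy F x) u)) ⟩
      base F x * w + (w * copyTotal F x + - 1# * copyForm F x)
        ≈⟨ solve 5 (λ g p t T i → g :* (p :+ t) :+ ((p :+ t) :* T :+ i) := (g :+ T) :* p :+ (t :* (g :+ T) :+ i))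
             refl (base F x) (act G D S x) τ (copyTotal F x) (- 1# * copyForm F x) ⟩
      S x * act G D S x + (τ * S x + - 1# * copyForm F x) ∎
      where w = act G D S x + τ

  corona-norm : ∀ F → inner K F F ≈ Σ G (λ x → base F x * base F x + inner H (copy F x) (copy F x))
  corona-norm F = Σ-⊙ G H (λ q → F q * F q)

-- The quadratic embedding constant

module QEC (em : ExcludedMiddle ℓ) (ℝ : CompleteOrderedField ℓ)
  (G : Graph) (conn : Graph.Connected G) where
  open GraphSums em ℝ
  open SetoidReasoning setoid
  open Graph G

  private
    D : V → C G
    D = distanceMatrix G conn

  opaque
    unfolding Σ

    inner≤0⇒≈0 : ∀ f → inner G f f ≤ 0# → ∀ x → f x ≈ 0#
    inner≤0⇒≈0 f ff≤0 x = trans (reflexive (≡.cong f (≡.sym (Inverse.strictlyInverseʳ enum x))))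
      (dot≤0⇒≈0 (f ∘ vertex) ff≤0 (Inverse.to enum x))

  form : C G → Carrier
  form f = inner G f (act G D f)

  normalise : ∀ {a} → 0# < a → ∃ λ c → c * c * a ≈ 1#
  normalise {a} 0<a = inverse-root (sqrt (proj₁ 0<a))
    where
    inverse-root : (∃ λ s → 0# ≤ s × s * s ≈ a) → ∃ λ c → c * c * a ≈ 1#
    inverse-root (s , _ , ss≈a) = s ⁻¹ , (begin
      s ⁻¹ * s ⁻¹ * a          ≈⟨ *-congˡ ss≈a ⟨
      s ⁻¹ * s ⁻¹ * (s * s)    ≈⟨ solve 2 (λ s i → i :* i :* (s :* s) := (s :* i) :* (s :* i)) refl s (s ⁻¹) ⟩
      (s * s ⁻¹) * (s * s ⁻¹)  ≈⟨ *-cong (⁻¹-inverseʳ s s≉0) (⁻¹-inverseʳ s s≉0) ⟩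
      1# * 1#                  ≈⟨ *-identityˡ 1# ⟩
      1#                       ∎)
      where
      s≉0 : ¬ s ≈ 0#
      s≉0 s≈0 = 0<x⇒x≉0 0<a (trans (sym ss≈a) (trans (*-congʳ s≈0) (zeroˡ s)))

  inner-scale : ∀ c f g → inner G (λ x → c * f x) (λ x → c * g x) ≈ c * c * inner G f g
  inner-scale c f g = trans
    (Σ-cong (λ x → solve 3 (λ c f g → (c :* f) :* (c :* g) := c :* c :* (f :* g)) refl c (f x) (g x)))
    (Σ-*ˡ (c * c) (λ x → f x * g x))

  act-scale : ∀ c f x → act G D (λ y → c * f y) x ≈ c * act G D f x
  act-scale c f x = trans
    (Σ-cong (λ y → solve 3 (λ d c f → d :* (c :* f) := c :* (d :* f)) refl (D x y) c (f y)))
    (Σ-*ˡ c (λ y → D x y * f y))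

  form-scale : ∀ c f → form (λ x → c * f x) ≈ c * c * form f
  form-scale c f = trans (Σ-cong (λ x → *-congˡ (act-scale c f x))) (inner-scale c f (act G D f))

  form-cong : ∀ {f g} → (∀ x → f x ≈ g x) → form f ≈ form g
  form-cong f≈g = Σ-cong (λ x → *-cong (f≈g x) (Σ-cong (λ y → *-congˡ (f≈g y))))

  Σ-𝟏 : ∀ f → inner G (𝟏 G) f ≈ Σ G f
  Σ-𝟏 f = Σ-cong (λ x → *-identityˡ (f x))

  -- The set whose maximum is QEC, restated through the opaque `Σ` and with Σ f in place of ⟨𝟏,f⟩.
  IsValue : Carrier → Set _
  IsValue r = ∃ λ f → inner G f f ≈ 1# × Σ G f ≈ 0# × form f ≈ r

  IsQEC⇒maximum : ∀ {q} → IsQEC G conn q → IsMaximum IsValue q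
  IsQEC⇒maximum {q} ((f , ff≈1 , 1f≈0 , fDf≈q) , upper) =
    ( f
    , trans (reflexive (inner-∑ f f)) ff≈1
    , trans (sym (Σ-𝟏 f)) (trans (reflexive (inner-∑ (𝟏 G) f)) 1f≈0)
    , trans (reflexive (inner-act-∑ D f f)) fDf≈q)
    , λ r (g , gg≈1 , g≈0 , gDg≈r) → upper r
      ( g
      , trans (reflexive (≡.sym (inner-∑ g g))) gg≈1
      , trans (reflexive (≡.sym (inner-∑ (𝟏 G) g))) (trans (Σ-𝟏 g) g≈0)
      , trans (reflexive (≡.sym (inner-act-∑ D g g))) gDg≈r)

  maximum⇒IsQEC : ∀ {q} → IsMaximum IsValue q → IsQEC G conn q
  maximum⇒IsQEC {q} ((f , ff≈1 , f≈0 , fDf≈q) , upper) =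
    ( f
    , trans (reflexive (≡.sym (inner-∑ f f))) ff≈1
    , trans (reflexive (≡.sym (inner-∑ (𝟏 G) f))) (trans (Σ-𝟏 f) f≈0)
    , trans (reflexive (≡.sym (inner-act-∑ D f f))) fDf≈q)
    , λ r (g , gg≈1 , 1g≈0 , gDg≈r) → upper r
      ( g
      , trans (reflexive (inner-∑ g g)) gg≈1
      , trans (sym (Σ-𝟏 g)) (trans (reflexive (inner-∑ (𝟏 G) g)) 1g≈0)
      , trans (reflexive (inner-act-∑ D g g)) gDg≈r)

  -- The homogeneous version of maximality, obtained by rescaling f to norm 1. A vector of norm 0
  -- cannot be rescaled, but it vanishes and both sides are 0.
  form-bound : ∀ {q} → IsMaximum IsValue q →
               ∀ f → Σ G f ≈ 0# → form f ≤ q * inner G f f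
  form-bound {q} (_ , upper) f f≈0 = [ positive , null ]′ (<-or-≥ 0# (inner G f f))
    where
    null : inner G f f ≤ 0# → form f ≤ q * inner G f f
    null ff≤0 = ≤-reflexive (trans (f*≈0 (act G D f)) (sym (trans (*-congˡ (f*≈0 f)) (zeroʳ q))))
      where
      f*≈0 : ∀ g → inner G f g ≈ 0#
      f*≈0 g = Σ-zero (λ x → trans (*-congʳ (inner≤0⇒≈0 f ff≤0 x)) (zeroˡ (g x)))
    positive : 0# < inner G f f → form f ≤ q * inner G f f
    positive 0<ff = ≤-resp₂ lhs (*-comm _ _) (*-monoˡ-≤ (proj₁ 0<ff) (upper (c * c * form f)
      ( (λ x → c * f x)
      , trans (inner-scale c f f) ccN≈1
      , trans (Σ-*ˡ c f) (trans (*-congˡ f≈0) (zeroʳ c))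
      , form-scale c f)))
      where
      N = inner G f f
      c = proj₁ (normalise 0<ff)
      ccN≈1 : c * c * N ≈ 1#
      ccN≈1 = proj₂ (normalise 0<ff)
      lhs : N * (c * c * form f) ≈ form f
      lhs = begin
        N * (c * c * form f)  ≈⟨ solve 3 (λ N c p → N :* (c :* c :* p) := (c :* c :* N) :* p) refl N c (form f) ⟩
        (c * c * N) * form f  ≈⟨ *-congʳ ccN≈1 ⟩
        1# * form f           ≈⟨ *-identityˡ _ ⟩
        form f                ∎

  -- Lets a maximiser be exhibited unnormalised, which keeps square roots of norms out of the
  -- computations in the corona.
  bound⇒maximum : ∀ {q} → (∀ f → Σ G f ≈ 0# → form f ≤ q * inner G f f) →
    ∀ f → 0# < inner G f f → Σ G f ≈ 0# → form f ≈ q * inner G f f → IsMaximum IsValue q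
  bound⇒maximum {q} bound f 0<ff f≈0 attained =
    ( (λ x → c * f x)
    , trans (inner-scale c f f) ccN≈1
    , trans (Σ-*ˡ c f) (trans (*-congˡ f≈0) (zeroʳ c))
    , (begin
        form (λ x → c * f x)  ≈⟨ form-scale c f ⟩
        c * c * form f        ≈⟨ *-congˡ attained ⟩
        c * c * (q * N)       ≈⟨ solve 3 (λ N c q → c :* c :* (q :* N) := (c :* c :* N) :* q) refl N c q ⟩
        (c * c * N) * q       ≈⟨ *-congʳ ccN≈1 ⟩
        1# * q                ≈⟨ *-identityˡ q ⟩
        q                     ∎))
    , λ r (g , gg≈1 , g≈0 , gDg≈r) →
        ≤-resp₂ gDg≈r (trans (*-congˡ gg≈1) (*-identityʳ q)) (bound g g≈0)
    where
    N = inner G f f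
    c = proj₁ (normalise 0<ff)
    ccN≈1 : c * c * N ≈ 1#
    ccN≈1 = proj₂ (normalise 0<ff)

-- Regular graphs with least adjacency eigenvalue -2

module RegularGraph (em : ExcludedMiddle ℓ) (ℝ : CompleteOrderedField ℓ) where
  open GraphSums em ℝ

  module LeastEigenvalue (H : Graph) (κ : ℕ) (1≤n : 1 ℕ.≤ Graph.order H)
    (regular : Graph.Regular H κ)
    (minimum : IsMinimum (ev H (adjacencyMatrix H)) (- fromℕ 2)) where
    open SetoidReasoning setoid
    open Graph H

    private
      A : V → C H
      A = adjacencyMatrix H

    n k : Carrier
    n = fromℕ order
    k = fromℕ (κ ℕ.+ 2)

    0<k : 0# < k
    0<k = fromℕ-positive (ℕ.≤-trans (s≤s z≤n) (ℕ.m≤n+m 2 κ))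

    A+2-scale : ∀ c h u → A+2 H (λ v → c * h v) u ≈ c * A+2 H h u
    A+2-scale c h u = begin
      act H A (λ v → c * h v) u + fromℕ 2 * (c * h u)
        ≈⟨ +-congʳ (trans (Σ-cong (λ v → solve 3 (λ a c h → a :* (c :* h) := c :* (a :* h)) refl (A u v) c (h v)))
                          (Σ-*ˡ c (λ v → A u v * h v))) ⟩
      c * act H A h u + fromℕ 2 * (c * h u)
        ≈⟨ solve 4 (λ c a t h → c :* a :+ t :* (c :* h) := c :* (a :+ t :* h)) refl c (act H A h u) (fromℕ 2) (h u) ⟩
      c * A+2 H h u ∎

    A+2-constant : ∀ c u → A+2 H (λ _ → c) u ≈ k * c
    A+2-constant c u = begin
      Σ H (λ v → A u v * c) + fromℕ 2 * c
        ≈⟨ +-congʳ (trans (Σ-cong (λ v → *-comm (A u v) c)) (Σ-*ˡ c (A u))) ⟩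
      c * Σ H (A u) + fromℕ 2 * c
        ≈⟨ +-congʳ (*-congˡ (trans (row-sum u) (reflexive (≡.cong fromℕ (regular u))))) ⟩
      c * fromℕ κ + fromℕ 2 * c
        ≈⟨ solve 3 (λ c a t → c :* a :+ t :* c := (a :+ t) :* c) refl c (fromℕ κ) (fromℕ 2) ⟩
      (fromℕ κ + fromℕ 2) * c
        ≈⟨ *-congʳ (×-homo-+ 1# κ 2) ⟨
      k * c ∎

    private
      M : Matrix order
      M i j = A (vertex i) (vertex j)

      B : Matrix order
      B = shift M (- fromℕ 2)

      M-sym : IsSymmetric M
      M-sym i j = adjacency-sym {H} (vertex i) (vertex j)

      B-sym : IsSymmetric B
      B-sym = shift-sym M-sym (- fromℕ 2)

      w : C H
      w = proj₁ (proj₁ minimum)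

    vertex-cover : {P : V → Set ℓ} → (∀ i → P (vertex i)) → ∀ x → P x
    vertex-cover {P} p x = ≡.subst P (Inverse.strictlyInverseʳ enum x) (p (Inverse.to enum x))

    opaque
      unfolding Σ

      mul-B : ∀ h i → mul B (h ∘ vertex) i ≈ A+2 H h (vertex i)
      mul-B h i = trans (mul-shift M (- fromℕ 2) (h ∘ vertex) i)
        (solve 3 (λ m t h → m :- (:- t) :* h := m :+ t :* h) refl (mul M (h ∘ vertex) i) (fromℕ 2) (h (vertex i)))

      quad-B : ∀ h → quad B (h ∘ vertex) ≈ inner H h (A+2 H h)
      quad-B h = dot-congʳ (mul-B h)

      -- Carries eigenvectors of the indexed matrix back to H, where the minimality of -2 is stated.
      eigenvector-extend : ∀ ν x → IsEigenvector M ν x → ev H A ν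
      eigenvector-extend ν x (x≉0 , Mx≈νx) = f ,
        (λ f≈0 → x≉0 (λ i → trans (sym (f-vertex i)) (f≈0 (vertex i)))) ,
        vertex-cover {λ u → apply H A f u ≈ ν * f u}
          (λ i → trans (dot-congʳ f-vertex) (trans (Mx≈νx i) (*-congˡ (sym (f-vertex i)))))
        where
        f : C H
        f = x ∘ Inverse.to enum
        f-vertex : ∀ i → f (vertex i) ≈ x i
        f-vertex i = reflexive (≡.cong x (Inverse.strictlyInverseˡ enum i))

      w-kernel : ∀ u → A+2 H w u ≈ 0#
      w-kernel u = trans (+-congʳ (proj₂ (proj₂ (proj₁ minimum)) u))
        (solve 2 (λ t w → (:- t) :* w :+ t :* w := con (+ 0)) refl (fromℕ 2) (w u))

      w-vertex-nonZero : NonZero (w ∘ vertex)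
      w-vertex-nonZero w≈0 = proj₁ (proj₂ (proj₁ minimum)) (vertex-cover {λ x → w x ≈ 0#} w≈0)

      0<ww : 0# < inner H w w
      0<ww = 0<dot w-vertex-nonZero

      B-nonNegative : ∀ x → 0# ≤ quad B x
      B-nonNegative x = ≤-respʳ (sym (quad-shift M (- fromℕ 2) x)) (x≤y⇒0≤y-x
        (least-eigenvalue-bound M-sym {w = w ∘ vertex} (w-vertex-nonZero , proj₂ (proj₂ (proj₁ minimum)) ∘ vertex)
          (λ ν y eigen → proj₂ minimum ν (eigenvector-extend ν y eigen)) x))

      A+2-nonNegative : ∀ h → 0# ≤ inner H h (A+2 H h)
      A+2-nonNegative h = ≤-respʳ (quad-B h) (B-nonNegative (h ∘ vertex))

      B-ones : ∀ i → mul B ones i ≈ k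
      B-ones i = trans (mul-B (λ _ → 1#) i) (trans (A+2-constant 1# (vertex i)) (*-identityʳ k))

      A+2-mean-bound : ∀ h → k * (Σ H h * Σ H h) ≤ n * inner H h (A+2 H h)
      A+2-mean-bound h = ≤-respʳ (*-congˡ (quad-B h))
        (mean-bound B-sym B-nonNegative B-ones (fromℕ-positive 1≤n) (h ∘ vertex))

      -- Cauchy-Schwarz against the all-one vector, as the case of the identity matrix with k = 1 in
      -- `mean-bound`.
      norm-mean-bound : ∀ h → Σ H h * Σ H h ≤ n * inner H h h
      norm-mean-bound h = ≤-resp₂ (*-identityˡ _) (*-congˡ (quad-identity (h ∘ vertex)))
        (mean-bound identity-sym (λ y → ≤-respʳ (sym (quad-identity y)) (0≤dot y)) (mul-identity ones)
          (fromℕ-positive 1≤n) (h ∘ vertex))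

      -- By symmetry k Σ w = ⟨w,(A + 2)𝟏⟩ = ⟨𝟏,(A + 2)w⟩ = 0, and k = κ + 2 is positive.
      Σw≈0 : Σ H w ≈ 0#
      Σw≈0 = x*y≈0⇒y≈0 (0<x⇒x≉0 0<k) (begin
        k * sum (w ∘ vertex)            ≈⟨ dot-constant (w ∘ vertex) k ⟨
        dot (w ∘ vertex) (λ _ → k)      ≈⟨ dot-congʳ B-ones ⟨
        dot (w ∘ vertex) (mul B ones)   ≈⟨ dot-self-adjoint B-sym (w ∘ vertex) ones ⟩
        dot ones (mul B (w ∘ vertex))   ≈⟨ sum-zero (λ i → trans (*-congˡ (trans (mul-B w i) (w-kernel (vertex i)))) (zeroʳ 1#)) ⟩
        0#                              ∎)
  
    kernel-vector : ∃ λ h → 0# < inner H h h × Σ H h ≈ 0# × (∀ u → A+2 H h u ≈ 0#)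
    kernel-vector = w , 0<ww , Σw≈0 , w-kernel

-- The embedding constant of the corona, by the sign of q

module CoronaQEC (em : ExcludedMiddle ℓ) (ℝ : CompleteOrderedField ℓ) where
  open GraphSums em ℝ

  module Value (G : Graph) (conn : Graph.Connected G) (2≤m : 2 ℕ.≤ Graph.order G)
    (H : Graph) (κ : ℕ) (1≤n : 1 ℕ.≤ Graph.order H) (regular : Graph.Regular H κ)
    (minimum : IsMinimum (ev H (adjacencyMatrix H)) (- fromℕ 2))
    (q : Carrier) (q-qec : IsQEC G conn q) where
    open SetoidReasoning setoid
    open CoronaForm em ℝ G H conn
    open RegularGraph.LeastEigenvalue em ℝ H κ 1≤n regular minimum
    private
      module G = QEC em ℝ G conn
      K = G ⊙ H
      module K = QEC em ℝ K (⊙-connected G H conn)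

    q-maximum : IsMaximum G.IsValue q
    q-maximum = G.IsQEC⇒maximum q-qec

    N : Carrier
    N = fromℕ (Graph.order H ℕ.+ 1)

    N≈n+1 : N ≈ n + 1#
    N≈n+1 = trans (×-homo-+ 1# (Graph.order H) 1) (+-congˡ (+-identityʳ 1#))

    0<n : 0# < n
    0<n = fromℕ-positive 1≤n

    open PsiInverse.Coefficients em ℝ n N k q N≈n+1 0<n 0<k public

    form⊙ : ∀ F → Σ G (vertexTotal F) ≈ 0# → K.form F ≈ G.form (vertexTotal F) - Σ G (copyForm F)
    form⊙ F S≈0 = corona-form F S≈0

    module NonPositive (q≤0 : q ≤ 0#) where

      -- Both parts of `corona-form` are nonpositive: the form of G because q ≤ 0, the correction
      -- because A + 2 is positive semidefinite.
      bound : ∀ F → Σ K F ≈ 0# → K.form F ≤ 0# * inner K F F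
      bound F F≈0 = ≤-resp₂ (sym (form⊙ F S≈0)) (sym (zeroˡ (inner K F F)))
        (≤-witness (+-nonNegative (x≤y⇒0≤y-x (≤-trans (G.form-bound q-maximum S S≈0) qSS≤0)) 0≤I)
          (solve 2 (λ p i → con (+ 0) := (p :- i) :+ ((con (+ 0) :- p) :+ i)) refl (G.form S) (Σ G (copyForm F))))
        where
        S = vertexTotal F
        S≈0 : Σ G S ≈ 0#
        S≈0 = trans (sym (Σ-vertexTotal F)) F≈0
        0≤SS : 0# ≤ inner G S S
        0≤SS = Σ-nonNegative (λ x → 0≤x*x (S x))
        qSS≤0 : q * inner G S S ≤ 0#
        qSS≤0 = ≤-resp₂ (*-comm _ _) (zeroʳ _) (*-monoˡ-≤ 0≤SS q≤0)
        0≤I : 0# ≤ Σ G (copyForm F)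
        0≤I = Σ-nonNegative (λ x → A+2-nonNegative (copy F x))

      w : C H
      w = proj₁ kernel-vector

      x₀ : Graph.V G
      x₀ = Graph.vertex G (fromℕ< (ℕ.≤-trans (s≤s z≤n) 2≤m))

      F : C K
      F (inj₁ x)       = 0#
      F (inj₂ (x , u)) = δ G x₀ x * w u

      S≈0-pointwise : ∀ x → vertexTotal F x ≈ 0#
      S≈0-pointwise x = trans (+-identityˡ _) (trans (Σ-*ˡ (δ G x₀ x) w)
        (trans (*-congˡ (proj₁ (proj₂ (proj₂ kernel-vector)))) (zeroʳ _)))

      S≈0 : Σ G (vertexTotal F) ≈ 0#
      S≈0 = Σ-zero S≈0-pointwise

      form≈0 : K.form F ≈ 0#
      form≈0 = begin
        K.form F
          ≈⟨ form⊙ F S≈0 ⟩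
        G.form (vertexTotal F) - Σ G (copyForm F)
          ≈⟨ +-cong (Σ-zero (λ x → trans (*-congʳ (S≈0-pointwise x)) (zeroˡ _))) (-‿cong (Σ-zero (λ x → Σ-zero (λ u →
               trans (*-congˡ (trans (A+2-scale (δ G x₀ x) w u)
                 (trans (*-congˡ (proj₂ (proj₂ (proj₂ kernel-vector)) u)) (zeroʳ _)))) (zeroʳ _))))) ⟩
        0# - 0#
          ≈⟨ -‿inverseʳ 0# ⟩
        0# ∎

      norm : inner K F F ≈ inner H w w
      norm = begin
        inner K F F
          ≈⟨ corona-norm F ⟩
        Σ G (λ x → 0# * 0# + inner H (copy F x) (copy F x))
          ≈⟨ Σ-cong (λ x → trans (trans (+-congʳ (zeroˡ 0#)) (+-identityˡ _))
               (trans (Σ-cong (λ u → solve 2 (λ d w → (d :* w) :* (d :* w) := d :* (d :* (w :* w))) refl (δ G x₀ x) (w u)))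
                 (trans (Σ-*ˡ (δ G x₀ x) (λ u → δ G x₀ x * (w u * w u))) (*-congˡ (Σ-*ˡ (δ G x₀ x) (λ u → w u * w u)))))) ⟩
        Σ G (λ x → δ G x₀ x * (δ G x₀ x * inner H w w))
          ≈⟨ Σ-δ x₀ (λ x → δ G x₀ x * inner H w w) ⟩
        δ G x₀ x₀ * inner H w w
          ≈⟨ trans (*-congʳ (δ-on x₀)) (*-identityˡ _) ⟩
        inner H w w ∎

      qec : IsQEC K (⊙-connected G H conn) 0#
      qec = K.maximum⇒IsQEC (K.bound⇒maximum bound F (<-respʳ (sym norm) (proj₁ (proj₂ kernel-vector)))
        (trans (Σ-vertexTotal F) S≈0) (trans form≈0 (sym (zeroˡ (inner K F F)))))

    module Positive (0<q : 0# < q) (s r : Carrier) (0≤s : 0# ≤ s) (ss≈disc : s * s ≈ disc)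
      (2r≈b+s : fromℕ 2 * r ≈ b + s) where
      open Root s r 0≤s ss≈disc 2r≈b+s using (module Positive)
      open Positive 0<q

      -- After multiplication by n, the hypotheses allow n I and n P to be lowered to k t² and t²,
      -- the latter because r > 0. What remains is the binary form of `form-nonNegative`.
      pointwise-bound : ∀ g t I P → k * (t * t) ≤ n * I → t * t ≤ n * P →
                        q * ((g + t) * (g + t)) + - 1# * I ≤ r * (g * g + P)
      pointwise-bound g t I P ktt≤nI tt≤nP = *-cancelˡ-≤ 0<n (≤-witness
        (+-nonNegative (+-nonNegative (form-nonNegative g t) (*-nonNegative (proj₁ 0<r) (x≤y⇒0≤y-x tt≤nP)))
          (x≤y⇒0≤y-x ktt≤nI))
        (solve 8 (λ n k q r g t I P →
          n :* (r :* (g :* g :+ P)) :=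
          n :* (q :* ((g :+ t) :* (g :+ t)) :+ (:- con (+ 1)) :* I) :+
          ((n :* (r :- q) :* (g :* g) :- (n :* q :* (g :* t) :+ n :* q :* (g :* t)) :+ (r :+ k :- n :* q) :* (t :* t))
           :+ r :* (n :* P :- t :* t) :+ (n :* I :- k :* (t :* t))))
          refl n k q r g t I P))

      bound : ∀ F → Σ K F ≈ 0# → K.form F ≤ r * inner K F F
      bound F F≈0 = ≤-respˡ (sym (form⊙ F S≈0)) (≤-trans
        (≤-witness (x≤y⇒0≤y-x (G.form-bound q-maximum S S≈0))
          (solve 3 (λ p t i → t :- i := (p :- i) :+ (t :- p)) refl (G.form S) (q * inner G S S) (Σ G (copyForm F))))
        (≤-resp₂ lhs rhs (Σ-mono-≤ (λ x → pointwise-bound (base F x) (copyTotal F x) (copyForm F x) (inner H (copy F x) (copy F x))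
          (A+2-mean-bound (copy F x)) (norm-mean-bound (copy F x))))))
        where
        S = vertexTotal F
        S≈0 : Σ G S ≈ 0#
        S≈0 = trans (sym (Σ-vertexTotal F)) F≈0
        lhs : Σ G (λ x → q * (S x * S x) + - 1# * copyForm F x) ≈ q * inner G S S - Σ G (copyForm F)
        lhs = trans (Σ-linear q (- 1#) (λ x → S x * S x) (copyForm F))
          (solve 2 (λ a i → a :+ (:- con (+ 1)) :* i := a :- i) refl (q * inner G S S) (Σ G (copyForm F)))
        rhs : Σ G (λ x → r * (base F x * base F x + inner H (copy F x) (copy F x))) ≈ r * inner K F F
        rhs = trans (Σ-*ˡ r (λ x → base F x * base F x + inner H (copy F x) (copy F x))) (*-congˡ (sym (corona-norm F)))

      private
        f : C G
        f = proj₁ (proj₁ q-maximum)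

        ff≈1 : inner G f f ≈ 1#
        ff≈1 = proj₁ (proj₂ (proj₁ q-maximum))

        f≈0 : Σ G f ≈ 0#
        f≈0 = proj₁ (proj₂ (proj₂ (proj₁ q-maximum)))

        fDf≈q : G.form f ≈ q
        fDf≈q = proj₂ (proj₂ (proj₂ (proj₁ q-maximum)))

      -- (g , t) = (n q , n (r - q)) spans the kernel of the binary form of form-nonNegative.
      F : C K
      F (inj₁ x)       = n * q * f x
      F (inj₂ (x , u)) = (r - q) * f x

      total≈ : ∀ x → vertexTotal F x ≈ n * r * f x
      total≈ x = begin
        n * q * f x + Σ H (λ _ → (r - q) * f x)
          ≈⟨ +-congˡ (Σ-constant ((r - q) * f x)) ⟩
        n * q * f x + n * ((r - q) * f x)
          ≈⟨ solve 4 (λ n q r f → n :* q :* f :+ n :* ((r :- q) :* f) := n :* r :* f) refl n q r (f x) ⟩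
        n * r * f x ∎

      Σtotal≈0 : Σ G (vertexTotal F) ≈ 0#
      Σtotal≈0 = trans (Σ-cong total≈) (trans (Σ-*ˡ (n * r) f) (trans (*-congˡ f≈0) (zeroʳ _)))

      copyForm≈ : ∀ x → copyForm F x ≈ n * k * ((r - q) * (r - q)) * (f x * f x)
      copyForm≈ x = begin
        Σ H (λ u → t * A+2 H (λ _ → t) u)
          ≈⟨ Σ-cong (λ u → *-congˡ (A+2-constant t u)) ⟩
        Σ H (λ u → t * (k * t))
          ≈⟨ Σ-constant (t * (k * t)) ⟩
        n * (t * (k * t))
          ≈⟨ solve 4 (λ n k d f → n :* ((d :* f) :* (k :* (d :* f))) := n :* k :* (d :* d) :* (f :* f)) refl n k (r - q) (f x) ⟩
        n * k * ((r - q) * (r - q)) * (f x * f x) ∎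
        where t = (r - q) * f x

      norm : inner K F F ≈ n * q * (n * q) + n * ((r - q) * (r - q))
      norm = begin
        inner K F F
          ≈⟨ corona-norm F ⟩
        Σ G (λ x → n * q * f x * (n * q * f x) + Σ H (λ _ → (r - q) * f x * ((r - q) * f x)))
          ≈⟨ Σ-cong (λ x → trans (+-congˡ (Σ-constant ((r - q) * f x * ((r - q) * f x))))
               (solve 4 (λ a n d f → a :* f :* (a :* f) :+ n :* (d :* f :* (d :* f)) := (a :* a :+ n :* (d :* d)) :* (f :* f))
                 refl (n * q) n (r - q) (f x))) ⟩
        Σ G (λ x → (n * q * (n * q) + n * ((r - q) * (r - q))) * (f x * f x))
          ≈⟨ Σ-*ˡ (n * q * (n * q) + n * ((r - q) * (r - q))) (λ x → f x * f x) ⟩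
        (n * q * (n * q) + n * ((r - q) * (r - q))) * inner G f f
          ≈⟨ trans (*-congˡ ff≈1) (*-identityʳ _) ⟩
        n * q * (n * q) + n * ((r - q) * (r - q)) ∎

      attained : K.form F ≈ r * inner K F F
      attained = begin
        K.form F
          ≈⟨ form⊙ F Σtotal≈0 ⟩
        G.form (vertexTotal F) - Σ G (copyForm F)
          ≈⟨ +-cong (trans (G.form-cong total≈) (trans (G.form-scale (n * r) f) (*-congˡ fDf≈q)))
               (-‿cong (trans (Σ-cong copyForm≈) (trans (Σ-*ˡ (n * k * ((r - q) * (r - q))) (λ x → f x * f x))
                 (trans (*-congˡ ff≈1) (*-identityʳ _))))) ⟩
        n * r * (n * r) * q - n * k * ((r - q) * (r - q))
          -- The two sides of the claim differ by n (r - q) times the defect n q r - (r + k)(r - q),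
          -- which `root-gap` makes zero.
          ≈⟨ solve 4 (λ n r q k → n :* r :* (n :* r) :* q :- n :* k :* ((r :- q) :* (r :- q))
               := r :* (n :* q :* (n :* q) :+ n :* ((r :- q) :* (r :- q)))
                  :+ n :* (r :- q) :* (n :* q :* r :- (r :+ k) :* (r :- q))) refl n r q k ⟩
        r * (n * q * (n * q) + n * ((r - q) * (r - q))) + n * (r - q) * (n * q * r - (r + k) * (r - q))
          ≈⟨ +-cong (*-congˡ (sym norm)) (*-congˡ (+-congˡ (-‿cong root-gap))) ⟩
        r * inner K F F + n * (r - q) * (n * q * r - n * q * r)
          ≈⟨ solve 3 (λ a b c → a :+ b :* (c :- c) := a) refl (r * inner K F F) (n * (r - q)) (n * q * r) ⟩
        r * inner K F F ∎

      0<norm : 0# < inner K F F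
      0<norm = <-respʳ (sym (trans norm (+-comm _ _)))
        (+-positive (*-positive 0<n (*-positive 0<r-q 0<r-q)) (0≤x*x (n * q)))

      qec : IsQEC K (⊙-connected G H conn) r
      qec = K.maximum⇒IsQEC (K.bound⇒maximum bound F 0<norm (trans (Σ-vertexTotal F) Σtotal≈0) attained)

theorem4p17 : ∀ {ℓ} → ExcludedMiddle ℓ → (ℝ : CompleteOrderedField ℓ) →
    let open Real ℝ in
    (G : Graph) (conn : Graph.Connected G) → 2 ℕ.≤ Graph.order G →
    (H : Graph) (n κ : ℕ) → 1 ℕ.≤ n → Graph.order H ≡ n → Graph.Regular H κ →
    IsMinimum (ev H (adjacencyMatrix H)) (- fromℕ 2) →
    ∀ q → IsQEC G conn q →
    let b = fromℕ (n ℕ.+ 1) * q - fromℕ (κ ℕ.+ 2) in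
    ∃ λ r → ∃ λ s →
    IsInverseValue (ψ-domain n κ) (ψ n κ) q r ×
    IsSqrt (b * b + fromℕ 4 * fromℕ (κ ℕ.+ 2) * q) s ×
    r ≈ (1# / fromℕ 2) * (b + s) ×
    (0# < q → IsQEC (G ⊙ H) (⊙-connected G H conn) r) ×
    (¬ (0# < q) → IsQEC (G ⊙ H) (⊙-connected G H conn) 0#)
theorem4p17 em ℝ G conn 2≤m H _ κ 1≤n ≡.refl regular minimum q q-qec =
  r , s , (r-domain , r-value , r-unique) , (0≤s , ss≈disc) , refl
    , (λ 0<q → Positive.qec 0<q s r 0≤s ss≈disc 2r≈b+s)
    , (λ 0≮q → NonPositive.qec ([ (λ 0<q → contradiction 0<q 0≮q) , (λ q≤0 → q≤0) ]′ (<-or-≥ 0# q)))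
  where
  open RealField em ℝ
  open CoronaQEC.Value em ℝ G conn 2≤m H κ 1≤n regular minimum q q-qec
  root : ∃ λ s → 0# ≤ s × s * s ≈ disc
  root = sqrt (proj₁ 0<disc)
  s : Carrier
  s = proj₁ root
  0≤s : 0# ≤ s
  0≤s = proj₁ (proj₂ root)
  ss≈disc : s * s ≈ disc
  ss≈disc = proj₂ (proj₂ root)
  r : Carrier
  r = (1# / fromℕ 2) * (b + s)
  2r≈b+s : fromℕ 2 * r ≈ b + s
  2r≈b+s = trans (sym (*-assoc _ _ _)) (trans (*-congʳ (/-cancel 0<2)) (*-identityˡ _))
  open Root s r 0≤s ss≈disc 2r≈b+s
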